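{- Let $\sigma=\{E,C_1,C_2\}$ with $E$ binary and $C_1,C_2$ unary. There are a class $\mathcal K$ of coloured graphs (over $\sigma$) of shrub-depth at most $2$, formulas $\varphi_V(x)$ and $\varphi_E(x_1,x_2)$ of the logic $\mathcal L_1$ (defined in the context) over $\sigma$, and a polynomial-time algorithm that, given a graph $G$ with vertex set $V(G)=\{1,\dots,n\}$, $n\ge 1$, computes a coloured graph $G'\in\mathcal K$ with $V(G)\subseteq V(G')$ such that for all $v\in V(G')$: $G'\models\varphi_V[v]$ if and only if $v\in V(G)$; and for all $v_1,v_2\in V(G)$: $G'\models\varphi_E[v_1,v_2]$ if and only if $\{v_1,v_2\}\in E(G)$. Hence, the model-checking problem for $\mathcal L_1$ is already $\mathsf{AW}[*]$-hard on a class of coloured graphs of shrub-depth at most $2$.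
   Context: Graphs are undirected without self-loops. A coloured graph over $\sigma$ is a $\sigma$-structure $G'$ with finite non-empty universe $V(G')$ in which $E(G')$ is a symmetric irreflexive relation and $C_1(G'),C_2(G')\subseteq V(G')$ are arbitrary subsets (colours). A class of graphs has shrub-depth at most $d$ if there is a number $m$ of labels such that for every graph $H$ in the class there is a rooted tree $T$ such that: the set of leaves of $T$ is exactly $V(H)$; every root-to-leaf path has length exactly $d$; each leaf is assigned one of $m$ labels; and whether $\{v_1,v_2\}$ is an edge of $H$ depends solely on the labels of $v_1$ and $v_2$ and on the distance between $v_1$ and $v_2$ in $T$. A class of coloured graphs has shrub-depth at most $d$ if the class of underlying uncoloured graphs (the $\{E\}$-reducts) has shrub-depth at most $d$. The logic $\mathcal L_1$ over $\sigma$ consists of formulas and counting terms built by the rules: (1) $x=y$, $E(x,y)$, $C_1(x)$, $C_2(x)$ are formulas; (2) formulas are closed under $\neg,\lor$ (and hence $\land$); (3) $\exists x\,\varphi$ is a formula; (4) if $\varphi$ is a formula and $\bar x$ a tuple of pairwise distinct variables, then $\#\bar x.\varphi$ is a counting term; (5) every integer is a counting term; (6) counting terms are closed under $+$ and $\cdot$; (7) if $t_1(x)$ and $t_2(y)$ are counting terms whose only free variables are (at most) $x$ and $y$ respectively, then $E(x,y)\land\mathsf P_=(t_1(x),t_2(y))$ is a formula. Semantics: first-order constructs as usual; $\#\bar x.\varphi$ evaluates to the number of tuples of elements that, assigned to $\bar x$, satisfy $\varphi$; $\mathsf P_=(t_1,t_2)$ holds iff $t_1$ and $t_2$ evaluate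 to the same integer. The model-checking problem for a logic on a class of structures asks, given a sentence of the logic and a structure of the class, whether the structure satisfies the sentence; it is parameterised by the sentence. Hardness for the parameterised complexity class $\mathsf{AW}[*]$ is under fixed-parameter reductions; first-order model checking on the class of all graphs is known to be $\mathsf{AW}[*]$-hard. -}

module Defs where

open import Data.Bool.Base using (Bool; true; false; not; _∧_; _∨_)
open import Data.Bool.Properties using () renaming (_≟_ to _≟ᵇ_)
open import Data.Empty using (⊥)
open import Data.Fin.Base using (Fin; toℕ)
open import Data.Fin.Properties using () renaming (_≟_ to _≟ᶠ_)
open import Data.Fin.Subset using (Subset; ∣_∣)
open import Data.Integer.Base using (ℤ; +_; -[1+_]) renaming (_+_ to _+ℤ_; _*_ to _*ℤ_)
open import Data.Integer.Properties using () renaming (_≟_ to _≟ℤ_)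
open import Data.List.Base using (List; []; _∷_; map; concatMap; allFin; any; all; filterᵇ; length; tabulate)
open import Data.Maybe.Base using (Maybe; just; nothing)
open import Data.Nat.Base using (ℕ; zero; suc; _+_; _*_; _^_; _≤_; NonZero)
open import Data.Nat.Binary.Base using (ℕᵇ; 2[1+_]; 1+[2_]; fromℕ)
open import Data.Product.Base using (Σ; ∃-syntax; _×_; _,_)
open import Data.Sum.Base using (_⊎_; inj₁; inj₂; [_,_]′)
open import Data.Vec.Base using (Vec; lookup; _++_) renaming ([] to []ᵛ; _∷_ to _∷ᵛ_)
open import Function.Base using (_∘_)
open import Function.Bundles using (_⇔_)
open import Function.Definitions using (Injective)
open import Relation.Binary.PropositionalEquality using (_≡_; _≢_)
open import Relation.Nullary using (¬_; does)

------------------------------------------------------------------------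
-- Graphs and coloured graphs

-- Finite structures have universe Fin order; the vertex called i in
-- {1,…,n} is the element of Fin n with toℕ equal to i - 1.
record Graph : Set where
  field
    order    : ℕ
    nonEmpty : NonZero order
    adj      : Fin order → Fin order → Bool
    adj-sym  : ∀ u v → adj u v ≡ adj v u
    adj-irr  : ∀ v → adj v v ≡ false

  V : Set
  V = Fin order

record ColouredGraph : Set where
  field
    graph : Graph
  open Graph graph public
  field
    c₁ c₂ : V → Bool

------------------------------------------------------------------------
-- Shrub-depth

data Path {A : Set} (R : A → A → Set) : A → A → ℕ → Set where
  []  : ∀ {x} → Path R x x 0
  _∷_ : ∀ {x y z k} → R x y → Path R y z k → Path R x z (suc k)

-- Every node has at most one parent, the root has none, and every node
-- is reached from the root; hence there are no cycles.
record RootedTree : Set where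
  field
    size   : ℕ
    root   : Fin size
    parent : Fin size → Maybe (Fin size)

  Node : Set
  Node = Fin size

  Child : Node → Node → Set
  Child x y = parent y ≡ just x

  Descent : Node → Node → ℕ → Set
  Descent = Path Child

  field
    root-orphan : parent root ≡ nothing
    reachable   : ∀ x → ∃[ k ] Descent root x k

  IsLeaf : Node → Set
  IsLeaf x = ∀ y → ¬ Child x y

  Walk : Node → Node → ℕ → Set
  Walk = Path (λ x y → Child x y ⊎ Child y x)

  Distance : Node → Node → ℕ → Set
  Distance x y k = Walk x y k × (∀ j → Walk x y j → k ≤ j)

-- V(H) is identified with the set of leaves through the injection leaf.
record TreeModel (d m : ℕ) (H : Graph) : Set where
  open Graph H
  field
    tree : RootedTree
  open RootedTree tree
  field
    leaf      : V → Node
    leaf-inj  : Injective _≡_ _≡_ leaf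
    leaves    : ∀ x → IsLeaf x ⇔ (∃[ v ] leaf v ≡ x)
    depth     : ∀ v k → Descent root (leaf v) k → k ≡ d
    label     : V → Fin m
    edge-rule : Fin m → Fin m → ℕ → Bool
    edges     : ∀ u v k → u ≢ v → Distance (leaf u) (leaf v) k →
                adj u v ≡ edge-rule (label u) (label v) k

ShrubDepth≤ : ℕ → (Graph → Set) → Set
ShrubDepth≤ d C = ∃[ m ] (∀ H → C H → TreeModel d m H)

Reducts : (ColouredGraph → Set) → (Graph → Set)
Reducts K H = ∃[ G ] (K G × H ≡ ColouredGraph.graph G)

------------------------------------------------------------------------
-- First-order logic over {E} and the logic L₁ over {E, C₁, C₂}
--
-- Well-scoped de Bruijn syntax: Formula n has free variables among
-- Fin n, and variable 0 is the most recently bound one.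

module FO where

  data Formula (n : ℕ) : Set where
    eq edge : Fin n → Fin n → Formula n
    neg     : Formula n → Formula n
    or      : Formula n → Formula n → Formula n
    ex      : Formula (suc n) → Formula n

  module _ (G : Graph) where
    open Graph G

    ⟦_⟧ : ∀ {n} → Formula n → Vec V n → Bool
    ⟦ eq x y ⟧   ρ = does (lookup ρ x ≟ᶠ lookup ρ y)
    ⟦ edge x y ⟧ ρ = adj (lookup ρ x) (lookup ρ y)
    ⟦ neg φ ⟧    ρ = not (⟦ φ ⟧ ρ)
    ⟦ or φ ψ ⟧   ρ = ⟦ φ ⟧ ρ ∨ ⟦ ψ ⟧ ρ
    ⟦ ex φ ⟧     ρ = any (λ v → ⟦ φ ⟧ (v ∷ᵛ ρ)) (allFin order)

  _⊨_ : Graph → Formula 0 → Set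
  G ⊨ φ = ⟦_⟧ G φ []ᵛ ≡ true

allTuples : (N k : ℕ) → List (Vec (Fin N) k)
allTuples N zero    = []ᵛ ∷ []
allTuples N (suc k) = concatMap (λ v → map (v ∷ᵛ_) (allTuples N k)) (allFin N)

module L₁ where

  -- edge-P₌ x y t₁ t₂ is the formula E(x,y) ∧ P₌(t₁(x),t₂(y)); the only
  -- variable of t₁ stands for x and the only variable of t₂ for y.
  -- count k φ is #(x₁,…,x_k).φ, binding the first k variables of φ.
  mutual
    data Formula (n : ℕ) : Set where
      eq edge : Fin n → Fin n → Formula n
      C₁ C₂   : Fin n → Formula n
      neg     : Formula n → Formula n
      or      : Formula n → Formula n → Formula n
      ex      : Formula (suc n) → Formula n
      edge-P₌ : (x y : Fin n) (t₁ t₂ : Term 1) → Formula n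

    data Term (n : ℕ) : Set where
      count   : (k : ℕ) → Formula (k + n) → Term n
      int     : ℤ → Term n
      add mul : Term n → Term n → Term n

  module _ (G : ColouredGraph) where
    open ColouredGraph G

    mutual
      ⟦_⟧ : ∀ {n} → Formula n → Vec V n → Bool
      ⟦ eq x y ⟧            ρ = does (lookup ρ x ≟ᶠ lookup ρ y)
      ⟦ edge x y ⟧          ρ = adj (lookup ρ x) (lookup ρ y)
      ⟦ C₁ x ⟧              ρ = c₁ (lookup ρ x)
      ⟦ C₂ x ⟧              ρ = c₂ (lookup ρ x)
      ⟦ neg φ ⟧             ρ = not (⟦ φ ⟧ ρ)
      ⟦ or φ ψ ⟧            ρ = ⟦ φ ⟧ ρ ∨ ⟦ ψ ⟧ ρ
      ⟦ ex φ ⟧              ρ = any (λ v → ⟦ φ ⟧ (v ∷ᵛ ρ)) (allFin order)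
      ⟦ edge-P₌ x y t₁ t₂ ⟧ ρ =
        adj (lookup ρ x) (lookup ρ y) ∧
        does (⟦ t₁ ⟧ᵗ (lookup ρ x ∷ᵛ []ᵛ) ≟ℤ ⟦ t₂ ⟧ᵗ (lookup ρ y ∷ᵛ []ᵛ))

      ⟦_⟧ᵗ : ∀ {n} → Term n → Vec V n → ℤ
      ⟦ count k φ ⟧ᵗ ρ = + length (filterᵇ (λ vs → ⟦ φ ⟧ (vs ++ ρ)) (allTuples order k))
      ⟦ int i ⟧ᵗ     ρ = i
      ⟦ add s t ⟧ᵗ   ρ = ⟦ s ⟧ᵗ ρ +ℤ ⟦ t ⟧ᵗ ρ
      ⟦ mul s t ⟧ᵗ   ρ = ⟦ s ⟧ᵗ ρ *ℤ ⟦ t ⟧ᵗ ρ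

  _⊨_[_] : ∀ {n} (G : ColouredGraph) → Formula n → Vec (ColouredGraph.V G) n → Set
  G ⊨ φ [ ρ ] = ⟦_⟧ G φ ρ ≡ true

  _⊨_ : ColouredGraph → Formula 0 → Set
  G ⊨ φ = G ⊨ φ [ []ᵛ ]

------------------------------------------------------------------------
-- Machine model: programs on binary trees with a cost semantics

data Tree : Set where
  nil : Tree
  _·_ : Tree → Tree → Tree

infixr 5 _·_

size : Tree → ℕ
size nil     = 1
size (a · b) = suc (size a + size b)

-- ite p q r: run q if p returns a non-nil tree, and r otherwise.
-- while p q: iterate q as long as p returns a non-nil tree.
-- rec p q:   on an input x · e, recursion over the tree x with
--            parameter e.
data Program : Set where
  id ε hd tl : Program
  _⨾_        : Program → Program → Program
  ⟨_,_⟩      : Program → Program → Program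
  ite        : Program → Program → Program → Program
  while      : Program → Program → Program
  rec        : Program → Program → Program

-- p ⊢ x ⇓ y [ t ]: on input x the program p halts with output y at
-- cost t.  The cost is at least the size of every tree produced (so that
-- sharing cannot yield exponentially large trees cheaply) and at least
-- the number of evaluation steps; hence, for bounds that are at least
-- the input size, it agrees with Turing machine time up to a polynomial.
infix 4 _⊢_⇓_[_]
data _⊢_⇓_[_] : Program → Tree → Tree → ℕ → Set where
  id-⇓     : ∀ {x} → id ⊢ x ⇓ x [ size x ]
  ε-⇓      : ∀ {x} → ε ⊢ x ⇓ nil [ 1 ]
  hd-nil   : hd ⊢ nil ⇓ nil [ 1 ]
  hd-·     : ∀ {a b} → hd ⊢ a · b ⇓ a [ size (a · b) ]
  tl-nil   : tl ⊢ nil ⇓ nil [ 1 ]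
  tl-·     : ∀ {a b} → tl ⊢ a · b ⇓ b [ size (a · b) ]
  ⨾-⇓      : ∀ {p q x y z s t} →
             p ⊢ x ⇓ y [ s ] → q ⊢ y ⇓ z [ t ] →
             p ⨾ q ⊢ x ⇓ z [ suc (s + t) ]
  pair-⇓   : ∀ {p q x y z s t} →
             p ⊢ x ⇓ y [ s ] → q ⊢ x ⇓ z [ t ] →
             ⟨ p , q ⟩ ⊢ x ⇓ y · z [ suc (s + t) ]
  ite-true : ∀ {p q r x a b y s t} →
             p ⊢ x ⇓ a · b [ s ] → q ⊢ x ⇓ y [ t ] →
             ite p q r ⊢ x ⇓ y [ suc (s + t) ]
  ite-false : ∀ {p q r x y s t} →
             p ⊢ x ⇓ nil [ s ] → r ⊢ x ⇓ y [ t ] →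
             ite p q r ⊢ x ⇓ y [ suc (s + t) ]
  while-stop : ∀ {p q x s} →
             p ⊢ x ⇓ nil [ s ] →
             while p q ⊢ x ⇓ x [ suc (s + size x) ]
  while-step : ∀ {p q x a b y z s t u} →
             p ⊢ x ⇓ a · b [ s ] → q ⊢ x ⇓ y [ t ] → while p q ⊢ y ⇓ z [ u ] →
             while p q ⊢ x ⇓ z [ suc (s + t + u) ]
  rec-∅    : ∀ {p q y s} →
             p ⊢ nil ⇓ y [ s ] →
             rec p q ⊢ nil ⇓ y [ suc s ]
  rec-nil  : ∀ {p q e y s} →
             p ⊢ e ⇓ y [ s ] →
             rec p q ⊢ nil · e ⇓ y [ suc (size e + s) ]
  rec-·    : ∀ {p q a b e u v y s t w} →
             rec p q ⊢ a · e ⇓ u [ s ] → rec p q ⊢ b · e ⇓ v [ t ] →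
             q ⊢ ((a · b) · e) · (u · v) ⇓ y [ w ] →
             rec p q ⊢ (a · b) · e ⇓ y [ suc (size ((a · b) · e) + s + t + w) ]

------------------------------------------------------------------------
-- Encodings of inputs

encList : {A : Set} → (A → Tree) → List A → Tree
encList enc []       = nil
encList enc (x ∷ xs) = enc x · encList enc xs

encPair : {A B : Set} → (A → Tree) → (B → Tree) → A × B → Tree
encPair encA encB (a , b) = encA a · encB b

encℕ : ℕ → Tree
encℕ zero    = nil
encℕ (suc n) = nil · encℕ n

encBool : Bool → Tree
encBool false = nil
encBool true  = nil · nil

encFin : ∀ {n} → Fin n → Tree
encFin = encℕ ∘ toℕ

encℕᵇ : ℕᵇ → Tree
encℕᵇ ℕᵇ.zero  = nil
encℕᵇ 2[1+ n ] = encBool true  · encℕᵇ n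
encℕᵇ 1+[2 n ] = encBool false · encℕᵇ n

encℤ : ℤ → Tree
encℤ (+ n)    = encBool true  · encℕᵇ (fromℕ n)
encℤ -[1+ n ] = encBool false · encℕᵇ (fromℕ n)

encSubset : ∀ {n} → (Fin n → Bool) → Tree
encSubset = encList encBool ∘ tabulate

encGraph : Graph → Tree
encGraph G = encList encSubset (tabulate (Graph.adj G))

encColouredGraph : ColouredGraph → Tree
encColouredGraph G = encGraph graph · encSubset c₁ · encSubset c₂
  where open ColouredGraph G

encFO : ∀ {n} → FO.Formula n → Tree
encFO (FO.eq x y)   = encℕ 0 · encFin x · encFin y
encFO (FO.edge x y) = encℕ 1 · encFin x · encFin y
encFO (FO.neg φ)    = encℕ 2 · encFO φ
encFO (FO.or φ ψ)   = encℕ 3 · encFO φ · encFO ψ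
encFO (FO.ex φ)     = encℕ 4 · encFO φ

mutual
  encL₁ : ∀ {n} → L₁.Formula n → Tree
  encL₁ (L₁.eq x y)            = encℕ 0 · encFin x · encFin y
  encL₁ (L₁.edge x y)          = encℕ 1 · encFin x · encFin y
  encL₁ (L₁.neg φ)             = encℕ 2 · encL₁ φ
  encL₁ (L₁.or φ ψ)            = encℕ 3 · encL₁ φ · encL₁ ψ
  encL₁ (L₁.ex φ)              = encℕ 4 · encL₁ φ
  encL₁ (L₁.C₁ x)              = encℕ 5 · encFin x
  encL₁ (L₁.C₂ x)              = encℕ 6 · encFin x
  encL₁ (L₁.edge-P₌ x y t₁ t₂) = encℕ 7 · (encFin x · encFin y) · (encTerm t₁ · encTerm t₂)

  encTerm : ∀ {n} → L₁.Term n → Tree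
  encTerm (L₁.count k φ) = encℕ 0 · encℕ k · encL₁ φ
  encTerm (L₁.int i)     = encℕ 1 · encℤ i
  encTerm (L₁.add s t)   = encℕ 2 · encTerm s · encTerm t
  encTerm (L₁.mul s t)   = encℕ 3 · encTerm s · encTerm t

------------------------------------------------------------------------
-- Polynomial time, computability, fixed-parameter reductions

PolyTime : {A B : Set} → (A → Tree) → (B → Tree) → (A → B) → Set
PolyTime encA encB f =
  Σ Program λ p → ∃[ c ] (∀ x → ∃[ t ]
    (p ⊢ encA x ⇓ encB (f x) [ t ] × t ≤ c * size (encA x) ^ c))

Computable : (ℕ → ℕ) → Set
Computable f = Σ Program λ p → ∀ n → ∃[ t ] p ⊢ encℕ n ⇓ encℕ (f n) [ t ]

record Problem : Set₁ where
  field
    Instance  : Set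
    encode    : Instance → Tree
    parameter : Instance → ℕ
    Yes       : Instance → Set

infix 4 _≤ᶠᵖᵗ_
record _≤ᶠᵖᵗ_ (P Q : Problem) : Set where
  private
    module P = Problem P
    module Q = Problem Q
  field
    reduce       : P.Instance → Q.Instance
    correct      : ∀ x → P.Yes x ⇔ Q.Yes (reduce x)
    program      : Program
    f            : ℕ → ℕ
    f-computable : Computable f
    c            : ℕ
    fpt-time     : ∀ x → ∃[ t ]
                   (program ⊢ P.encode x ⇓ Q.encode (reduce x) [ t ] ×
                    t ≤ f (P.parameter x) * size (P.encode x) ^ c)
    g            : ℕ → ℕ
    g-computable : Computable g
    parameter-≤  : ∀ x → Q.parameter (reduce x) ≤ g (P.parameter x)

------------------------------------------------------------------------
-- The class AW[*]: the closure under fixed-parameter reductions of the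
-- problems QBFSAT t, t ≥ 1 (parameterised quantified satisfiability of
-- t-normalised propositional formulas), following Abrahamson, Downey
-- and Fellows.

-- t-normalised formulas (products of sums of products … of literals with
-- t alternations).  A literal (b , x) is x if b = true, and ¬x otherwise.
Normalised : ℕ → Set → Set
Normalised zero    X = Bool × X
Normalised (suc t) X = List (Normalised t X)

mutual
  ⋀-eval : ∀ {X} t → (X → Bool) → Normalised t X → Bool
  ⋀-eval zero    α (b , x) = does (α x ≟ᵇ b)
  ⋀-eval (suc t) α φs      = all (⋁-eval t α) φs

  ⋁-eval : ∀ {X} t → (X → Bool) → Normalised t X → Bool
  ⋁-eval zero    α (b , x) = does (α x ≟ᵇ b)
  ⋁-eval (suc t) α φs      = any (⋀-eval t α) φs

encNormalised : ∀ {X} → (X → Tree) → ∀ t → Normalised t X → Tree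
encNormalised encX zero    = encPair encBool encX
encNormalised encX (suc t) = encList (encNormalised encX t)

-- A block (m , k) is a set s of m variables together with the size k of
-- the subsets of s that are quantified over.
Blocks : Set
Blocks = List (ℕ × ℕ)

Var : Blocks → Set
Var []             = ⊥
Var ((m , k) ∷ bs) = Fin m ⊎ Var bs

-- The j-th variable of the i-th block is encoded as the pair (i , j).
encVar : ∀ bs → Var bs → Tree
encVar bs = go 0 bs
  where
  go : ℕ → ∀ bs → Var bs → Tree
  go i (_ ∷ bs) (inj₁ j) = encℕ i · encFin j
  go i (_ ∷ bs) (inj₂ x) = go (suc i) bs x

-- ∃ t₁ ⊆ s₁ of size k₁, ∀ t₂ ⊆ s₂ of size k₂, … such that W holds of the
-- assignment making exactly the variables in t₁ ∪ t₂ ∪ … true.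
mutual
  ∃-first : ∀ bs → ((Var bs → Bool) → Set) → Set
  ∃-first []             W = W λ ()
  ∃-first ((m , k) ∷ bs) W = Σ (Subset m) λ s →
    ∣ s ∣ ≡ k × ∀-first bs (λ α → W [ lookup s , α ]′)

  ∀-first : ∀ bs → ((Var bs → Bool) → Set) → Set
  ∀-first []             W = W λ ()
  ∀-first ((m , k) ∷ bs) W = (s : Subset m) →
    ∣ s ∣ ≡ k → ∃-first bs (λ α → W [ lookup s , α ]′)

-- The parameter is r + k₁ + … + k_r for r blocks.
blocks-parameter : Blocks → ℕ
blocks-parameter []             = 0
blocks-parameter ((m , k) ∷ bs) = suc k + blocks-parameter bs

QBFSAT : ℕ → Problem
QBFSAT t = record
  { Instance  = Σ Blocks λ bs → Normalised t (Var bs)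
  ; encode    = λ (bs , φ) → encList (encPair encℕ encℕ) bs · encNormalised (encVar bs) t φ
  ; parameter = λ (bs , φ) → blocks-parameter bs
  ; Yes       = λ (bs , φ) → ∃-first bs (λ α → ⋀-eval t α φ ≡ true)
  }

AW[*] : Problem → Set
AW[*] Q = ∃[ t ] (1 ≤ t × Q ≤ᶠᵖᵗ QBFSAT t)

AW[*]-hard : Problem → Set₁
AW[*]-hard P = ∀ Q → AW[*] Q → Q ≤ᶠᵖᵗ P

------------------------------------------------------------------------
-- Model checking, parameterised by the length of the sentence

FO-ModelChecking : (Graph → Set) → Problem
FO-ModelChecking C = record
  { Instance  = FO.Formula 0 × Σ Graph C
  ; encode    = λ (φ , G , _) → encFO φ · encGraph G
  ; parameter = λ (φ , _) → size (encFO φ)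
  ; Yes       = λ (φ , G , _) → G FO.⊨ φ
  }

L₁-ModelChecking : (ColouredGraph → Set) → Problem
L₁-ModelChecking K = record
  { Instance  = L₁.Formula 0 × Σ ColouredGraph K
  ; encode    = λ (φ , G , _) → encL₁ φ · encColouredGraph G
  ; parameter = λ (φ , _) → size (encL₁ φ)
  ; Yes       = λ (φ , G , _) → G L₁.⊨ φ
  }

{-# OPTIONS --safe #-}

-- G becomes a disjoint union of stars plus all edges between the centres that stand for
-- vertices and those that stand for edges of G.  Which star belongs to which vertex or
-- edge is recorded in the numbers of coloured leaves: the star of vertex i has i leaves
-- of colour 2 only, that of the edge (b , i) has b leaves of colour 1 only and i leaves
-- of colour 2 only.  Hence x ~ y iff some edge centre w, necessarily adjacent to both,
-- passes the two equality tests on E(x,w) and E(y,w); and since edges depend only on the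
-- kinds of the two vertices and on whether they lie in the same star, depth 2 suffices.
-- For the hardness, quantifiers are relativised to the vertex centres.  This translation
-- of sentences is itself polynomial, so it can be composed with any fixed-parameter
-- reduction to first-order model checking.

module Submission where

open import Defs
open import Data.Bool.Base using (Bool; true; false; not; _∧_; _∨_; if_then_else_)
open import Data.Bool.ListAction using (any)
open import Data.Bool.Properties
  using (T-≡; ∨-comm; ∧-zeroʳ; ∧-identityʳ; ∧-conicalˡ; ∧-conicalʳ; not-involutive)
open import Data.Fin.Base
  using (Fin; zero; suc; toℕ; inject₁; inject≤; fromℕ; splitAt; remQuot; combine; _↑ˡ_; _↑ʳ_)
open import Data.Fin.Properties
  using (toℕ-injective; toℕ-inject₁; toℕ-fromℕ; toℕ-inject≤; inject≤-injective; toℕ<n; toℕ-↑ˡ;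
         splitAt-↑ˡ; splitAt-↑ʳ; join-splitAt; remQuot-combine; combine-remQuot;
         suc-injective; ↑ˡ-injective; ↑ʳ-injective)
  renaming (_≟_ to _≟ᶠ_)
open import Data.Integer.Base using (ℤ; +_)
open import Data.Integer.Properties using (+-injective) renaming (_≟_ to _≟ℤ_)
open import Data.List.Base as List using (List; []; _∷_; allFin; concatMap; filterᵇ; length)
open import Data.List.Membership.Propositional using (lose; find)
open import Data.List.Membership.Propositional.Properties using (∈-allFin)
open import Data.List.Relation.Unary.Any.Properties using (any⁺; any⁻)
open import Data.Maybe.Base using (Maybe; just; nothing)
open import Data.Maybe.Properties using (just-injective)
open import Data.Nat.Base using (ℕ; zero; suc; _+_; _*_; _^_; _≤_; _<ᵇ_; z≤n; s≤s; NonZero)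
open import Data.Nat.Properties hiding (suc-injective)
open import Data.Nat.Tactic.RingSolver using (solve-∀)
open import Data.Product.Base using (Σ; ∃; ∃-syntax; _×_; _,_; proj₁; proj₂)
open import Data.Sum.Base using (inj₁; inj₂; [_,_]′)
open import Data.Unit.Base using (⊤)
open import Data.Vec.Base as Vec using (Vec; lookup; []; _∷_)
open import Data.Vec.Properties using (lookup-map)
open import Function.Base using (_∘_)
open import Function.Bundles using (_⇔_; Equivalence; mk⇔)
open import Relation.Binary.PropositionalEquality
  using (_≡_; _≢_; refl; sym; trans; cong; cong₂; subst; subst₂; module ≡-Reasoning)
open import Relation.Nullary using (¬_; Dec; does; yes; contradiction)
open import Relation.Nullary.Decidable using (does-⇔; dec-true; _×-dec_)
open import Algebra.Properties.Monoid.Sum +-0-monoid using (sum; sum-cong-≗; sum-replicate-zero)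

-- Polynomials

-- The predicate `P₌` may compare counts only along an edge, so every pair of vertices that has to
-- be compared must already be adjacent. The complete bipartite graph between the two kinds of
-- centres makes all these comparisons available without revealing anything about G; G enters only
-- through the choice of the pairs whose centre is switched on. A pair has to store two numbers,
-- hence the two colours of leaves, and vertex centres carry both colours to be told apart from
-- leaves and from uncoloured edge centres. Stars differ in size, which would make a direct
-- numbering of their vertices awkward. The universe is therefore a full product of coordinates,
-- with isolated uncoloured vertices at the surplus positions; it stays polynomial in size, and
-- numbering becomes division with remainder. In the machine model the obstacle is that a recursion
-- could square the size of its result at each step. Recursions thus come with size bounds, which
-- have to hold on all trees and not only on encodings.

data Poly : Set where
  con     : ℕ → Poly
  var     : Poly
  _⊕_ _⊗_ : Poly → Poly → Poly

infixl 6 _⊕_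
infixl 7 _⊗_

eval : Poly → ℕ → ℕ
eval (con k) n = k
eval var     n = n
eval (P ⊕ Q) n = eval P n + eval Q n
eval (P ⊗ Q) n = eval P n * eval Q n

-- Only an upper bound on the degree: adding in the case of `⊕` as well gives both summands a common
-- exponent without a maximum.
deg : Poly → ℕ
deg (con k) = 0
deg var     = 1
deg (P ⊕ Q) = deg P + deg Q
deg (P ⊗ Q) = deg P + deg Q

infixl 8 _∘ₚ_
_∘ₚ_ : Poly → Poly → Poly
con k   ∘ₚ R = con k
var     ∘ₚ R = R
(P ⊕ Q) ∘ₚ R = P ∘ₚ R ⊕ Q ∘ₚ R
(P ⊗ Q) ∘ₚ R = P ∘ₚ R ⊗ Q ∘ₚ R

eval-∘ₚ : ∀ P R n → eval (P ∘ₚ R) n ≡ eval P (eval R n)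
eval-∘ₚ (con k) R n = refl
eval-∘ₚ var     R n = refl
eval-∘ₚ (P ⊕ Q) R n = cong₂ _+_ (eval-∘ₚ P R n) (eval-∘ₚ Q R n)
eval-∘ₚ (P ⊗ Q) R n = cong₂ _*_ (eval-∘ₚ P R n) (eval-∘ₚ Q R n)

eval-mono : ∀ P {m n} → m ≤ n → eval P m ≤ eval P n
eval-mono (con k) m≤n = ≤-refl
eval-mono var     m≤n = m≤n
eval-mono (P ⊕ Q) m≤n = +-mono-≤ (eval-mono P m≤n) (eval-mono Q m≤n)
eval-mono (P ⊗ Q) m≤n = *-mono-≤ (eval-mono P m≤n) (eval-mono Q m≤n)

-- Brings bounds into the two required shapes: m = 1 yields a constant times a power of the input
-- size, and for m depending on the parameter the right-hand side is a fixed-parameter bound. Since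
-- n is positive, its powers increase with the exponent.
eval-* : ∀ P m {n} → .{{NonZero n}} → eval P (m * n) ≤ eval P m * n ^ deg P
eval-* (con k) m {n} = ≤-reflexive (sym (*-identityʳ k))
eval-* var     m {n} = ≤-reflexive (cong (m *_) (sym (*-identityʳ n)))
eval-* (P ⊕ Q) m {n} = begin
  eval P (m * n) + eval Q (m * n)
    ≤⟨ +-mono-≤ (eval-* P m) (eval-* Q m) ⟩
  eval P m * n ^ deg P + eval Q m * n ^ deg Q
    ≤⟨ +-mono-≤ (*-monoʳ-≤ (eval P m) (^-monoʳ-≤ n (m≤m+n (deg P) (deg Q))))
                (*-monoʳ-≤ (eval Q m) (^-monoʳ-≤ n (m≤n+m (deg Q) (deg P)))) ⟩
  eval P m * n ^ (deg P + deg Q) + eval Q m * n ^ (deg P + deg Q)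
    ≡⟨ *-distribʳ-+ (n ^ (deg P + deg Q)) (eval P m) (eval Q m) ⟨
  (eval P m + eval Q m) * n ^ (deg P + deg Q) ∎
  where open ≤-Reasoning
eval-* (P ⊗ Q) m {n} = begin
  eval P (m * n) * eval Q (m * n)
    ≤⟨ *-mono-≤ (eval-* P m) (eval-* Q m) ⟩
  (eval P m * n ^ deg P) * (eval Q m * n ^ deg Q)
    ≡⟨ [m*n]*[o*p]≡[m*o]*[n*p] (eval P m) (n ^ deg P) (eval Q m) (n ^ deg Q) ⟩
  eval P m * eval Q m * (n ^ deg P * n ^ deg Q)
    ≡⟨ cong (eval P m * eval Q m *_) (^-distribˡ-+-* n (deg P) (deg Q)) ⟨
  eval P m * eval Q m * n ^ (deg P + deg Q) ∎
  where open ≤-Reasoning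

-- Sizes of trees and costs of programs

1≤size : ∀ x → 1 ≤ size x
1≤size nil     = ≤-refl
1≤size (a · b) = s≤s z≤n

instance
  size-nonZero : ∀ {x} → NonZero (size x)
  size-nonZero {nil}   = _
  size-nonZero {a · b} = _

sizes≤size· : ∀ a b → size a + size b ≤ size (a · b)
sizes≤size· a b = n≤1+n _

size≤cost : ∀ {p x y t} → p ⊢ x ⇓ y [ t ] → size y ≤ t
size≤cost id-⇓               = ≤-refl
size≤cost ε-⇓                = ≤-refl
size≤cost hd-nil             = ≤-refl
size≤cost (hd-· {a} {b})     = ≤-trans (m≤m+n (size a) (size b)) (n≤1+n _)
size≤cost tl-nil             = ≤-refl
size≤cost (tl-· {a} {b})     = ≤-trans (m≤n+m (size b) (size a)) (n≤1+n _)
size≤cost (⨾-⇓ {s = s} d e)  = ≤-trans (size≤cost e) (≤-trans (m≤n+m _ s) (n≤1+n _))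
size≤cost (pair-⇓ d e)       = s≤s (+-mono-≤ (size≤cost d) (size≤cost e))
size≤cost (ite-true {s = s} d e)  = ≤-trans (size≤cost e) (≤-trans (m≤n+m _ s) (n≤1+n _))
size≤cost (ite-false {s = s} d e) = ≤-trans (size≤cost e) (≤-trans (m≤n+m _ s) (n≤1+n _))
size≤cost (while-stop {s = s} d)  = ≤-trans (m≤n+m _ s) (n≤1+n _)
size≤cost (while-step {s = s} {t = t} d e f) =
  ≤-trans (size≤cost f) (≤-trans (m≤n+m _ (s + t)) (n≤1+n _))
size≤cost (rec-∅ d)          = ≤-trans (size≤cost d) (n≤1+n _)
size≤cost (rec-nil {e = e} d) = ≤-trans (size≤cost d) (≤-trans (m≤n+m _ (size e)) (n≤1+n _))
size≤cost (rec-· {w = w} d e f) = ≤-trans (size≤cost f) (≤-trans (m≤n+m w _) (n≤1+n _))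

-- Functions on trees computable in polynomial time

-- Separates cost from correctness: what a program computes is a function on trees that can be
-- reasoned about by equations alone.
record PolyFun (f : Tree → Tree) : Set where
  field
    program : Program
    bound   : Poly
    run     : ∀ x → ∃[ t ] (program ⊢ x ⇓ f x [ t ] × t ≤ eval bound (size x))

  size-≤ : ∀ x → size (f x) ≤ eval bound (size x)
  size-≤ x = let (_ , d , t≤) = run x in ≤-trans (size≤cost d) t≤

open PolyFun

private variable
  f g h : Tree → Tree

hdᵗ tlᵗ : Tree → Tree
hdᵗ nil     = nil
hdᵗ (a · b) = a
tlᵗ nil     = nil
tlᵗ (a · b) = b

ifᵗ : Tree → Tree → Tree → Tree
ifᵗ nil     y z = z
ifᵗ (_ · _) y z = y

idᵖ : PolyFun (λ x → x)
idᵖ = record { program = id ; bound = var ; run = λ x → size x , id-⇓ , ≤-refl }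

hdᵖ : PolyFun hdᵗ
hdᵖ = record { program = hd ; bound = var ; run = λ where
  nil     → 1 , hd-nil , ≤-refl
  (a · b) → size (a · b) , hd-· , ≤-refl }

tlᵖ : PolyFun tlᵗ
tlᵖ = record { program = tl ; bound = var ; run = λ where
  nil     → 1 , tl-nil , ≤-refl
  (a · b) → size (a · b) , tl-· , ≤-refl }

infixl 4 _⟫_
_⟫_ : PolyFun f → PolyFun g → PolyFun (λ x → g (f x))
_⟫_ {f} {g} F G = record
  { program = program F ⨾ program G
  ; bound   = con 1 ⊕ (bound F ⊕ bound G ∘ₚ bound F)
  ; run     = λ x → let (_ , d , s≤) = run F x ; (_ , e , t≤) = run G (f x) in
      _ , ⨾-⇓ d e , s≤s (+-mono-≤ s≤ (≤-trans t≤ (≤-trans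
        (eval-mono (bound G) (size-≤ F x))
        (≤-reflexive (sym (eval-∘ₚ (bound G) (bound F) (size x)))))))
  }

⟨_,_⟩ᵖ : PolyFun f → PolyFun g → PolyFun (λ x → f x · g x)
⟨ F , G ⟩ᵖ = record
  { program = ⟨ program F , program G ⟩
  ; bound   = con 1 ⊕ (bound F ⊕ bound G)
  ; run     = λ x → let (_ , d , s≤) = run F x ; (_ , e , t≤) = run G x in
      _ , pair-⇓ d e , s≤s (+-mono-≤ s≤ t≤)
  }

nilᵖ : PolyFun (λ _ → nil)
nilᵖ = record { program = ε ; bound = con 1 ; run = λ x → 1 , ε-⇓ , ≤-refl }

constᵖ : ∀ c → PolyFun (λ _ → c)
constᵖ nil     = nilᵖ
constᵖ (a · b) = ⟨ constᵖ a , constᵖ b ⟩ᵖ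

ifᵖ : PolyFun f → PolyFun g → PolyFun h → PolyFun (λ x → ifᵗ (f x) (g x) (h x))
ifᵖ {f} {g} {h} F G H = record
  { program = ite (program F) (program G) (program H)
  ; bound   = con 1 ⊕ (bound F ⊕ (bound G ⊕ bound H))
  ; run     = λ x → let (_ , d , s≤) = run F x in branch x (f x) d s≤
  }
  where
  branch : ∀ x c {s} → program F ⊢ x ⇓ c [ s ] → s ≤ eval (bound F) (size x) →
           ∃[ t ] (ite (program F) (program G) (program H) ⊢ x ⇓ ifᵗ c (g x) (h x) [ t ] ×
                   t ≤ suc (eval (bound F) (size x) + (eval (bound G) (size x) + eval (bound H) (size x))))
  branch x nil     d s≤ = let (_ , e , t≤) = run H x in
    _ , ite-false d e , s≤s (+-mono-≤ s≤ (≤-trans t≤ (m≤n+m _ (eval (bound G) (size x)))))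
  branch x (_ · _) d s≤ = let (_ , e , t≤) = run G x in
    _ , ite-true d e , s≤s (+-mono-≤ s≤ (≤-trans t≤ (m≤m+n _ (eval (bound H) (size x)))))

recᵗ : (Tree → Tree) → (Tree → Tree) → Tree → Tree → Tree
recᵗ b s nil     e = b e
recᵗ b s (x · y) e = s (((x · y) · e) · (recᵗ b s x e · recᵗ b s y e))

private
  regroup : ∀ N S a b → suc (suc N + a + b + S) ≡ 2 + (N + S) + a + b
  regroup = solve-∀

  distribute : ∀ W a b → W + a * W + b * W ≡ (1 + a + b) * W
  distribute = solve-∀

-- A recursion is only polynomial if its values are: hence the size bound B.
recᵖ : PolyFun f → PolyFun g → (B : Poly) →
       (∀ x e → size (recᵗ f g x e) ≤ eval B (size x + size e)) →
       PolyFun (λ z → recᵗ f g (hdᵗ z) (tlᵗ z))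
recᵖ {f} {g} F G B size≤ = record
  { program = rec (program F) (program G)
  ; bound   = var ⊗ W
  ; run     = λ where
      nil → let (_ , d , t≤) = run F nil in
        _ , rec-∅ d , ≤-trans (s≤s t≤) (≤-trans
          (s≤s (≤-trans (m≤m+n _ (eval S 1)) (m≤n+m _ 2))) (≤-reflexive (sym (*-identityˡ (eval W 1)))))
      (x · e) → let (t , d , t≤) = go (size (x · e)) x e (sizes≤size· x e) in
        t , d , ≤-trans t≤ (*-monoˡ-≤ (eval W (size (x · e)))
          (≤-trans (m≤m+n (size x) (size e)) (n≤1+n _)))
  }
  where
  S W : Poly
  S = bound G ∘ₚ (con 1 ⊕ (con 1 ⊕ var) ⊕ (con 1 ⊕ (B ⊕ B)))
  W = con 2 ⊕ (var ⊕ (bound F ⊕ S))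

  -- `N` stays fixed while `x` shrinks, so every node of `x` is charged the same amount `W` at `N`,
  -- and the total is linear in the size of `x`. The argument of `bound G` in `S` is the size of a
  -- step input: the current subproblem and two recursive values bounded by `B`.
  go : ∀ N x e → size x + size e ≤ N →
       ∃[ t ] (rec (program F) (program G) ⊢ x · e ⇓ recᵗ f g x e [ t ] × t ≤ size x * eval W N)
  go N nil e |x|+|e|≤N = let (s , d , s≤) = run F e ; |e|≤N = ≤-trans (n≤1+n _) |x|+|e|≤N in
    _ , rec-nil d , ≤-trans
      (s≤s (+-mono-≤ (≤-trans |e|≤N (n≤1+n N)) (≤-trans s≤
        (≤-trans (eval-mono (bound F) |e|≤N) (m≤m+n _ (eval S N))))))
      (≤-reflexive (sym (*-identityˡ (eval W N))))
  go N (x · y) e |xy|+|e|≤N =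
    let |x|≤ = ≤-trans (m≤m+n (size x) (size y)) (n≤1+n _)
        |y|≤ = ≤-trans (m≤n+m (size y) (size x)) (n≤1+n _)
        |x|+|e|≤N = ≤-trans (+-monoˡ-≤ (size e) |x|≤) |xy|+|e|≤N
        |y|+|e|≤N = ≤-trans (+-monoˡ-≤ (size e) |y|≤) |xy|+|e|≤N
        (s , d , s≤) = go N x e |x|+|e|≤N
        (t , d′ , t≤) = go N y e |y|+|e|≤N
        (w , d″ , w≤) = run G (((x · y) · e) · (recᵗ f g x e · recᵗ f g y e))
        w≤S : w ≤ eval S N
        w≤S = ≤-trans w≤ (≤-trans
          (eval-mono (bound G) (s≤s (+-mono-≤ (s≤s |xy|+|e|≤N)
            (s≤s (+-mono-≤ (≤-trans (size≤ x e) (eval-mono B |x|+|e|≤N))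
                           (≤-trans (size≤ y e) (eval-mono B |y|+|e|≤N)))))))
          (≤-reflexive (sym (eval-∘ₚ (bound G) (con 1 ⊕ (con 1 ⊕ var) ⊕ (con 1 ⊕ (B ⊕ B))) N))))
    in _ , rec-· d d′ d″ , (begin
      suc (size ((x · y) · e) + s + t + w)
        ≤⟨ s≤s (+-mono-≤ (+-mono-≤ (+-mono-≤ (s≤s |xy|+|e|≤N) s≤) t≤) w≤S) ⟩
      suc (suc N + size x * eval W N + size y * eval W N + eval S N)
        ≡⟨ regroup N (eval S N) (size x * eval W N) (size y * eval W N) ⟩
      2 + (N + eval S N) + size x * eval W N + size y * eval W N
        ≤⟨ +-monoˡ-≤ _ (+-monoˡ-≤ _ (+-monoʳ-≤ 2 (+-monoʳ-≤ N (m≤n+m _ (eval (bound F) N))))) ⟩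
      eval W N + size x * eval W N + size y * eval W N
        ≡⟨ distribute (eval W N) (size x) (size y) ⟩
      size (x · y) * eval W N ∎)
    where open ≤-Reasoning

-- The common case: every step adds at most a polynomial amount to the sizes of
-- the recursive results.
growthᵖ : PolyFun f → PolyFun g → (D : Poly) →
          (∀ x y e u v → size (g (((x · y) · e) · (u · v))) ≤
                         size u + size v + eval D (size (x · y) + size e)) →
          PolyFun (λ z → recᵗ f g (hdᵗ z) (tlᵗ z))
growthᵖ {f} {g} F G D grows = recᵖ F G (var ⊗ C) λ x e →
  ≤-trans (go _ x e ≤-refl) (*-monoˡ-≤ (eval C (size x + size e)) (m≤m+n (size x) (size e)))
  where
  C : Poly
  C = bound F ⊕ D

  go : ∀ N x e → size x + size e ≤ N → size (recᵗ f g x e) ≤ size x * eval C N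
  go N nil e |x|+|e|≤N = ≤-trans (size-≤ F e) (≤-trans
    (eval-mono (bound F) (≤-trans (n≤1+n _) |x|+|e|≤N))
    (≤-trans (m≤m+n _ (eval D N)) (≤-reflexive (sym (*-identityˡ _)))))
  go N (x · y) e |xy|+|e|≤N = begin
    size (g (((x · y) · e) · (recᵗ f g x e · recᵗ f g y e)))
      ≤⟨ grows x y e _ _ ⟩
    size (recᵗ f g x e) + size (recᵗ f g y e) + eval D (size (x · y) + size e)
      ≤⟨ +-mono-≤ (+-mono-≤ (go N x e (≤-trans (+-monoˡ-≤ (size e) |x|≤) |xy|+|e|≤N))
                            (go N y e (≤-trans (+-monoˡ-≤ (size e) |y|≤) |xy|+|e|≤N)))
                  (≤-trans (eval-mono D |xy|+|e|≤N) (m≤n+m _ (eval (bound F) N))) ⟩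
    size x * eval C N + size y * eval C N + eval C N
      ≡⟨ trans (+-comm _ (eval C N)) (sym (+-assoc (eval C N) _ _)) ⟩
    eval C N + size x * eval C N + size y * eval C N
      ≡⟨ distribute (eval C N) (size x) (size y) ⟩
    size (x · y) * eval C N ∎
    where
    open ≤-Reasoning
    |x|≤ = ≤-trans (m≤m+n (size x) (size y)) (n≤1+n _)
    |y|≤ = ≤-trans (m≤n+m (size y) (size x)) (n≤1+n _)


-- Programs for Booleans, unary numbers and lists

infixr 6 _∧ᵗ_
infixr 5 _∨ᵗ_
_∧ᵗ_ _∨ᵗ_ : Tree → Tree → Tree
x ∧ᵗ y = ifᵗ x y nil
x ∨ᵗ y = ifᵗ x (encBool true) y

notᵗ : Tree → Tree
notᵗ x = ifᵗ x nil (encBool true)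

infixr 6 _∧ᵖ_
infixr 5 _∨ᵖ_
_∧ᵖ_ : PolyFun f → PolyFun g → PolyFun (λ x → f x ∧ᵗ g x)
F ∧ᵖ G = ifᵖ F G nilᵖ

_∨ᵖ_ : PolyFun f → PolyFun g → PolyFun (λ x → f x ∨ᵗ g x)
F ∨ᵖ G = ifᵖ F (constᵖ (encBool true)) G

notᵖ : PolyFun f → PolyFun (λ x → notᵗ (f x))
notᵖ F = ifᵖ F nilᵖ (constᵖ (encBool true))

∧ᵗ-encBool : ∀ a b → encBool a ∧ᵗ encBool b ≡ encBool (a ∧ b)
∧ᵗ-encBool false b = refl
∧ᵗ-encBool true  b = refl

∨ᵗ-encBool : ∀ a b → encBool a ∨ᵗ encBool b ≡ encBool (a ∨ b)
∨ᵗ-encBool false b = refl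
∨ᵗ-encBool true  b = refl

notᵗ-encBool : ∀ b → notᵗ (encBool b) ≡ encBool (not b)
notᵗ-encBool false = refl
notᵗ-encBool true  = refl

ifᵗ-encBool : ∀ {A : Set} (enc : A → Tree) b x y →
              ifᵗ (encBool b) (enc x) (enc y) ≡ enc (if b then x else y)
ifᵗ-encBool enc false x y = refl
ifᵗ-encBool enc true  x y = refl

size-hdᵗ : ∀ x → size (hdᵗ x) ≤ size x
size-hdᵗ = size-≤ hdᵖ

size-tlᵗ : ∀ x → size (tlᵗ x) ≤ size x
size-tlᵗ = size-≤ tlᵖ

-- The input of the step function of a recursion has the form ((x · y) · e) · (u · v).
stepHead stepTail stepParam stepRest : Tree → Tree
stepHead  z = hdᵗ (hdᵗ (hdᵗ z))
stepTail  z = tlᵗ (hdᵗ (hdᵗ z))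
stepParam z = tlᵗ (hdᵗ z)
stepRest  z = tlᵗ (tlᵗ z)

stepHeadᵖ : PolyFun stepHead
stepHeadᵖ = hdᵖ ⟫ hdᵖ ⟫ hdᵖ

stepTailᵖ : PolyFun stepTail
stepTailᵖ = hdᵖ ⟫ hdᵖ ⟫ tlᵖ

stepParamᵖ : PolyFun stepParam
stepParamᵖ = hdᵖ ⟫ tlᵖ

stepRestᵖ : PolyFun stepRest
stepRestᵖ = tlᵖ ⟫ tlᵖ

-- Iterates `tlᵗ` once per entry of the first list; the recursive value for the head is discarded.
-- On lists this gives access to an entry, on unary numbers it is truncated subtraction, from which
-- the comparisons are derived.
dropᵗ : Tree → Tree → Tree
dropᵗ = recᵗ (λ e → e) (λ z → tlᵗ (stepRest z))

dropᵖ : PolyFun f → PolyFun g → PolyFun (λ x → dropᵗ (f x) (g x))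
dropᵖ F G = ⟨ F , G ⟩ᵖ ⟫ growthᵖ idᵖ (stepRestᵖ ⟫ tlᵖ) (con 0)
  (λ x y e u v → ≤-trans (size-tlᵗ v) (≤-trans (m≤n+m _ (size u)) (m≤m+n _ 0)))

dropᵗ-· : ∀ k x y → dropᵗ (encℕ (suc k)) (x · y) ≡ dropᵗ (encℕ k) y
dropᵗ-· zero    x y = refl
dropᵗ-· (suc k) x y = cong tlᵗ (dropᵗ-· k x y)

dropᵗ-nil : ∀ k → dropᵗ (encℕ k) nil ≡ nil
dropᵗ-nil zero    = refl
dropᵗ-nil (suc k) = cong tlᵗ (dropᵗ-nil k)

ltᵗ eqᵗ : Tree → Tree → Tree
ltᵗ x y = ifᵗ (dropᵗ x y) (encBool true) nil
eqᵗ x y = notᵗ (ltᵗ x y) ∧ᵗ notᵗ (ltᵗ y x)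

ltᵖ : PolyFun f → PolyFun g → PolyFun (λ x → ltᵗ (f x) (g x))
ltᵖ F G = ifᵖ (dropᵖ F G) (constᵖ (encBool true)) nilᵖ

eqᵖ : PolyFun f → PolyFun g → PolyFun (λ x → eqᵗ (f x) (g x))
eqᵖ F G = notᵖ (ltᵖ F G) ∧ᵖ notᵖ (ltᵖ G F)

ltᵗ-encℕ : ∀ m n → ltᵗ (encℕ m) (encℕ n) ≡ encBool (m <ᵇ n)
ltᵗ-encℕ m       zero    = cong (λ x → ifᵗ x (encBool true) nil) (dropᵗ-nil m)
ltᵗ-encℕ zero    (suc n) = refl
ltᵗ-encℕ (suc m) (suc n) =
  trans (cong (λ x → ifᵗ x (encBool true) nil) (dropᵗ-· m nil (encℕ n))) (ltᵗ-encℕ m n)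

eqᵗ-encℕ : ∀ m n → eqᵗ (encℕ m) (encℕ n) ≡ encBool (does (m ≟ n))
eqᵗ-encℕ m n = trans
  (cong₂ (λ x y → notᵗ x ∧ᵗ notᵗ y) (ltᵗ-encℕ m n) (ltᵗ-encℕ n m)) (trans
  (cong₂ _∧ᵗ_ (notᵗ-encBool (m <ᵇ n)) (notᵗ-encBool (n <ᵇ m))) (trans
  (∧ᵗ-encBool (not (m <ᵇ n)) (not (n <ᵇ m)))
  (cong encBool (not-<ᵇ-both m n))))
  where
  not-<ᵇ-both : ∀ m n → not (m <ᵇ n) ∧ not (n <ᵇ m) ≡ does (m ≟ n)
  not-<ᵇ-both zero    zero    = refl
  not-<ᵇ-both zero    (suc n) = refl
  not-<ᵇ-both (suc m) zero    = refl
  not-<ᵇ-both (suc m) (suc n) = not-<ᵇ-both m n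

-- mapOntoᵗ g xs (p · ys) is the list of all g (x · p), x in xs, followed by ys.
mapOntoStep : (Tree → Tree) → Tree → Tree
mapOntoStep g z = g (stepHead z · hdᵗ (stepParam z)) · stepRest z

mapOntoᵗ : (Tree → Tree) → Tree → Tree → Tree
mapOntoᵗ g = recᵗ tlᵗ (mapOntoStep g)

mapOntoᵖ : PolyFun g → PolyFun (λ z → mapOntoᵗ g (hdᵗ z) (tlᵗ z))
mapOntoᵖ {g} G =
  growthᵖ tlᵖ ⟨ ⟨ stepHeadᵖ , stepParamᵖ ⟫ hdᵖ ⟩ᵖ ⟫ G , stepRestᵖ ⟩ᵖ (con 1 ⊕ D) λ x y e u v → begin
    suc (size (g (x · hdᵗ e)) + size v)
      ≤⟨ s≤s (+-monoˡ-≤ (size v) (≤-trans (size-≤ G _) (eval-mono (bound G)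
           (s≤s (+-mono-≤ (≤-trans (m≤m+n (size x) (size y)) (n≤1+n _)) (size-hdᵗ e)))))) ⟩
    suc (eval (bound G) (suc (size (x · y) + size e)) + size v)
      ≡⟨ cong (λ k → suc (k + size v)) (eval-∘ₚ (bound G) (con 1 ⊕ var) (size (x · y) + size e)) ⟨
    suc (eval D (size (x · y) + size e) + size v)
      ≡⟨ +-comm _ (size v) ⟩
    size v + suc (eval D (size (x · y) + size e))
      ≤⟨ +-monoˡ-≤ _ (m≤n+m (size v) (size u)) ⟩
    size u + size v + suc (eval D (size (x · y) + size e)) ∎
  where
  open ≤-Reasoning
  D : Poly
  D = bound G ∘ₚ (con 1 ⊕ var)

mapᵗ : (Tree → Tree) → Tree → Tree → Tree
mapᵗ g xs p = mapOntoᵗ g xs (p · nil)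

mapᵖ : PolyFun g → PolyFun f → PolyFun h → PolyFun (λ z → mapᵗ g (f z) (h z))
mapᵖ G F H = ⟨ F , ⟨ H , nilᵖ ⟩ᵖ ⟩ᵖ ⟫ mapOntoᵖ G

appendᵗ : Tree → Tree → Tree
appendᵗ x y = mapOntoᵗ hdᵗ x (nil · y)

appendᵖ : PolyFun f → PolyFun g → PolyFun (λ x → appendᵗ (f x) (g x))
appendᵖ F G = ⟨ F , ⟨ nilᵖ , G ⟩ᵖ ⟩ᵖ ⟫ mapOntoᵖ hdᵖ

size-appendᵗ : ∀ x y → size (appendᵗ x y) ≤ size x + size y
size-appendᵗ nil     y = n≤1+n _
size-appendᵗ (a · x) y = s≤s (≤-trans (+-monoʳ-≤ (size a) (size-appendᵗ x y))
                                      (≤-reflexive (sym (+-assoc (size a) (size x) (size y)))))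

-- The tail of a unary number is its predecessor, which is the last entry to be listed.
rangeᵗ : Tree → Tree
rangeᵗ x = recᵗ (λ _ → nil) (λ z → appendᵗ (stepRest z) (stepTail z · nil)) x nil

rangeᵖ : PolyFun f → PolyFun (λ x → rangeᵗ (f x))
rangeᵖ F = ⟨ F , nilᵖ ⟩ᵖ ⟫
  growthᵖ nilᵖ (appendᵖ stepRestᵖ ⟨ stepTailᵖ , nilᵖ ⟩ᵖ) (con 1 ⊕ var) λ x y e u v → begin
    size (appendᵗ v (y · nil))
      ≤⟨ size-appendᵗ v (y · nil) ⟩
    size v + suc (size y + 1)
      ≤⟨ +-mono-≤ (m≤n+m (size v) (size u))
           (s≤s (+-mono-≤ (≤-trans (m≤n+m (size y) (size x)) (n≤1+n _)) (1≤size e))) ⟩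
    size u + size v + suc (size (x · y) + size e) ∎
  where open ≤-Reasoning

swapᵗ : Tree → Tree
swapᵗ z = tlᵗ z · hdᵗ z

swapᵖ : PolyFun swapᵗ
swapᵖ = ⟨ tlᵖ , hdᵖ ⟩ᵖ

-- Each row is put in front of the remaining product. This is the row-major order in which `remQuot`
-- numbers pairs; `swapᵗ` is needed because `mapOntoᵗ` supplies its parameter second.
productᵗ : Tree → Tree → Tree
productᵗ = recᵗ (λ _ → nil) (λ z → mapOntoᵗ swapᵗ (stepParam z) (stepHead z · stepRest z))

private
  expand : ∀ p w x r → suc (suc (p + w) + (x * (2 + p) + r)) + w * (1 + p) ≡ (1 + w + x) * (2 + p) + r
  expand = solve-∀

size-mapOnto-swapᵗ : ∀ x p r → size (mapOntoᵗ swapᵗ x (p · r)) ≤ size x * (2 + size p) + size r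
size-mapOnto-swapᵗ nil     p r = m≤n+m (size r) _
size-mapOnto-swapᵗ (w · x) p r = begin
  suc (suc (size p + size w) + size (mapOntoᵗ swapᵗ x (p · r)))
    ≤⟨ s≤s (+-monoʳ-≤ (suc (size p + size w)) (size-mapOnto-swapᵗ x p r)) ⟩
  suc (suc (size p + size w) + (size x * (2 + size p) + size r))
    ≤⟨ m≤m+n _ (size w * (1 + size p)) ⟩
  suc (suc (size p + size w) + (size x * (2 + size p) + size r)) + size w * (1 + size p)
    ≡⟨ expand (size p) (size w) (size x) (size r) ⟩
  size (w · x) * (2 + size p) + size r ∎
  where open ≤-Reasoning

productᵖ : PolyFun f → PolyFun g → PolyFun (λ x → productᵗ (f x) (g x))
productᵖ F G = ⟨ F , G ⟩ᵖ ⟫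
  growthᵖ nilᵖ (⟨ stepParamᵖ , ⟨ stepHeadᵖ , stepRestᵖ ⟩ᵖ ⟩ᵖ ⟫ mapOntoᵖ swapᵖ) (var ⊗ (con 2 ⊕ var))
  λ x y e u v → begin
    size (mapOntoᵗ swapᵗ e (x · v))
      ≤⟨ size-mapOnto-swapᵗ e x v ⟩
    size e * (2 + size x) + size v
      ≡⟨ +-comm _ (size v) ⟩
    size v + size e * (2 + size x)
      ≤⟨ +-mono-≤ (m≤n+m (size v) (size u)) (*-mono-≤ (m≤n+m (size e) (size (x · y)))
           (+-monoʳ-≤ 2 (≤-trans (m≤m+n (size x) (size y)) (≤-trans (n≤1+n _) (m≤m+n _ (size e)))))) ⟩
    size u + size v + (size (x · y) + size e) * (2 + (size (x · y) + size e)) ∎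
  where open ≤-Reasoning

-- Encoded lists as tables of functions on `Fin n`

table : ∀ n → (Fin n → Tree) → Tree
table zero    f = nil
table (suc n) f = f zero · table n (f ∘ suc)

table-cong : ∀ n {f g : Fin n → Tree} → (∀ i → f i ≡ g i) → table n f ≡ table n g
table-cong zero    f≗g = refl
table-cong (suc n) f≗g = cong₂ _·_ (f≗g zero) (table-cong n (f≗g ∘ suc))

encList-tabulate : ∀ {A : Set} (enc : A → Tree) n (f : Fin n → A) →
                   encList enc (List.tabulate f) ≡ table n (enc ∘ f)
encList-tabulate enc zero    f = refl
encList-tabulate enc (suc n) f = cong (enc (f zero) ·_) (encList-tabulate enc n (f ∘ suc))

encℕ-table : ∀ n → table n (λ _ → nil) ≡ encℕ n
encℕ-table zero    = refl
encℕ-table (suc n) = cong (nil ·_) (encℕ-table n)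

lookup-table : ∀ n (f : Fin n → Tree) i → hdᵗ (dropᵗ (encFin i) (table n f)) ≡ f i
lookup-table (suc n) f zero    = refl
lookup-table (suc n) f (suc i) =
  trans (cong hdᵗ (dropᵗ-· (toℕ i) (f zero) (table n (f ∘ suc)))) (lookup-table n (f ∘ suc) i)

mapOntoᵗ-table : ∀ m k (g : Tree → Tree) p (f : Fin m → Tree) (h : Fin k → Tree) →
  mapOntoᵗ g (table m f) (p · table k h) ≡
  table (m + k) (λ u → [ (λ i → g (f i · p)) , h ]′ (splitAt m u))
mapOntoᵗ-table zero    k g p f h = refl
mapOntoᵗ-table (suc m) k g p f h = cong (g (f zero · p) ·_)
  (trans (mapOntoᵗ-table m k g p (f ∘ suc) h) (table-cong (m + k) shift))
  where
  shift : ∀ u → [ (λ i → g (f (suc i) · p)) , h ]′ (splitAt m u) ≡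
                [ (λ i → g (f i · p)) , h ]′ (splitAt (suc m) (suc u))
  shift u with splitAt m u
  ... | inj₁ i = refl
  ... | inj₂ j = refl

mapᵗ-table : ∀ n (g : Tree → Tree) p (f : Fin n → Tree) →
             mapᵗ g (table n f) p ≡ table n (λ i → g (f i · p))
mapᵗ-table zero    g p f = refl
mapᵗ-table (suc n) g p f = cong (g (f zero · p) ·_) (mapᵗ-table n g p (f ∘ suc))

table-∷ʳ : ∀ n (f : Fin (suc n) → Tree) →
           table (suc n) f ≡ appendᵗ (table n (f ∘ inject₁)) (f (fromℕ n) · nil)
table-∷ʳ zero    f = refl
table-∷ʳ (suc n) f = cong (f zero ·_) (table-∷ʳ n (f ∘ suc))

rangeᵗ-encℕ : ∀ n → rangeᵗ (encℕ n) ≡ table n encFin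
rangeᵗ-encℕ zero    = refl
rangeᵗ-encℕ (suc n) = sym (trans (table-∷ʳ n encFin) (cong₂ (λ x y → appendᵗ x (y · nil))
  (trans (table-cong n (λ i → cong encℕ (toℕ-inject₁ i))) (sym (rangeᵗ-encℕ n)))
  (cong encℕ (toℕ-fromℕ n))))

productᵗ-table : ∀ m k (f : Fin m → Tree) (h : Fin k → Tree) →
  productᵗ (table m f) (table k h) ≡
  table (m * k) (λ u → f (proj₁ (remQuot k u)) · h (proj₂ (remQuot {m} k u)))
productᵗ-table zero    k f h = refl
productᵗ-table (suc m) k f h = trans
  (cong (λ r → mapOntoᵗ swapᵗ (table k h) (f zero · r)) (productᵗ-table m k (f ∘ suc) h))
  (trans (mapOntoᵗ-table k (m * k) swapᵗ (f zero) h _) (table-cong (k + m * k) split))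
  where
  split : ∀ u → [ (λ j → f zero · h j) ,
                  (λ w → f (suc (proj₁ (remQuot k w))) · h (proj₂ (remQuot {m} k w))) ]′ (splitAt k u) ≡
                f (proj₁ (remQuot k u)) · h (proj₂ (remQuot {suc m} k u))
  split u with splitAt k u
  ... | inj₁ j = refl
  ... | inj₂ w = refl

-- The coloured graph of a graph

-- vtx: the vertices of G; edg: the active edge centres; lft and rgt: the counted
-- leaves; off: the vertices without edges.
Class : Set
Class = Fin 5

pattern vtx = zero
pattern edg = suc zero
pattern lft = suc (suc zero)
pattern rgt = suc (suc (suc zero))
pattern off = suc (suc (suc (suc zero)))

isVtx isEdg isLft isRgt isCentre isLeaf colour₁ colour₂ : Class → Bool
isVtx vtx     = true
isVtx (suc _) = false
isEdg edg = true
isEdg _   = false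
isLft lft = true
isLft _   = false
isRgt rgt = true
isRgt _   = false
isCentre c = isVtx c ∨ isEdg c
isLeaf   c = isLft c ∨ isRgt c
colour₁  c = isVtx c ∨ isLft c
colour₂  c = isVtx c ∨ isRgt c

-- The flag s says whether the two vertices lie in the same component.
joins joinsˢ : Class → Class → Bool → Bool
joins  c d s = isVtx c ∧ isEdg d ∨ (isCentre c ∧ isLeaf d) ∧ s
joinsˢ c d s = joins c d s ∨ joins d c s

joinsˢ-irr : ∀ c s → joinsˢ c c s ≡ false
joinsˢ-irr vtx s = refl
joinsˢ-irr edg s = refl
joinsˢ-irr lft s = refl
joinsˢ-irr rgt s = refl
joinsˢ-irr off s = refl

module Coding (G : Graph) where
  open Graph G renaming (order to n)

  -- Position (t , k , (a , i)) has the component (a , i).  The centre (0 , 0) of the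
  -- component (0 , i) is the vertex i of G; that of (1 + b , i) stands for the pair
  -- (b , i), which the numbers b of lft leaves and i of rgt leaves identify.
  classAt : Fin 2 → Fin (suc n) → Fin (suc n) → Fin n → Class
  classAt zero    zero      zero    i = vtx
  classAt zero    zero      (suc b) i = if adj b i then edg else off
  -- Slot 0 of part 0 is taken by the centre, so the condition selects the slots k with 1 ≤ k < 1 +
  -- b, which are b many; part 1 has no centre and counts from 0. Leaves exist for inactive pairs as
  -- well, but then have no centre to be joined to.
  classAt zero    k@(suc _) a       i = if toℕ k <ᵇ toℕ a then lft else off
  classAt (suc _) k         a       i = if toℕ k <ᵇ toℕ i then rgt else off

  Component : Set
  Component = Fin (suc n * n)

  -- The order of the factors matters: the vertices of G have all coordinates zero except the last,
  -- and so receive the first n numbers.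
  order⁺ : ℕ
  order⁺ = 2 * (suc n * (suc n * n))

  part : Fin order⁺ → Fin 2
  part u = proj₁ (remQuot (suc n * (suc n * n)) u)

  slot : Fin order⁺ → Fin (suc n)
  slot u = proj₁ (remQuot (suc n * n) (proj₂ (remQuot {2} (suc n * (suc n * n)) u)))

  component : Fin order⁺ → Component
  component u = proj₂ (remQuot {suc n} (suc n * n) (proj₂ (remQuot {2} (suc n * (suc n * n)) u)))

  major : Component → Fin (suc n)
  major c = proj₁ (remQuot n c)

  minor : Component → Fin n
  minor c = proj₂ (remQuot {suc n} n c)

  classIn : Fin 2 → Fin (suc n) → Component → Class
  classIn t k c = classAt t k (major c) (minor c)

  class : Fin order⁺ → Class
  class u = classIn (part u) (slot u) (component u)

  joinsᵘ adj⁺ : Fin order⁺ → Fin order⁺ → Bool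
  joinsᵘ u v = joins (class u) (class v) (does (component u ≟ᶠ component v))
  adj⁺ u v = joinsᵘ u v ∨ joinsᵘ v u

  same-sym : ∀ u v → does (component u ≟ᶠ component v) ≡ does (component v ≟ᶠ component u)
  same-sym u v = does-⇔ (mk⇔ sym sym) (component u ≟ᶠ component v) (component v ≟ᶠ component u)

  -- In `adj⁺` each direction makes its own component test, so that symmetry is commutativity of the
  -- disjunction; the tree model needs one common flag.
  adj⁺-rule : ∀ u v → adj⁺ u v ≡ joinsˢ (class u) (class v) (does (component u ≟ᶠ component v))
  adj⁺-rule u v = cong (λ s → joinsᵘ u v ∨ joins (class v) (class u) s) (sym (same-sym u v))

  coloured : ColouredGraph
  coloured = record
    { graph = record
      { order    = order⁺
      ; nonEmpty = m*n≢0 2 (suc n * (suc n * n))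
          {{_}} {{m*n≢0 (suc n) (suc n * n) {{_}} {{m*n≢0 (suc n) n {{_}} {{nonEmpty}}}}}}
      ; adj      = adj⁺
      ; adj-sym  = λ u v → ∨-comm (joinsᵘ u v) (joinsᵘ v u)
      ; adj-irr  = λ v → joinsˢ-irr (class v) _
      }
    ; c₁ = λ u → colour₁ (class u)
    ; c₂ = λ u → colour₂ (class u)
    }

open Coding using (coloured)

-- Computing the coloured graph

-- Stores the four truth values from which adjacency and colours are Boolean combinations, so the
-- program evaluates the same expressions as the definitions. The class `off` has all four false.
encClass : Class → Tree
encClass c = (encBool (isVtx c) · encBool (isEdg c)) · (encBool (isLft c) · encBool (isRgt c))

classᵗ : Tree → Tree → Tree → Tree → Tree → Tree
classᵗ t k a i g =
  ifᵗ t (ifᵗ (ltᵗ k i) (encClass rgt) (encClass off))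
  (ifᵗ k (ifᵗ (ltᵗ k a) (encClass lft) (encClass off))
  (ifᵗ a (ifᵗ (hdᵗ (dropᵗ i (hdᵗ (dropᵗ (tlᵗ a) g)))) (encClass edg) (encClass off))
         (encClass vtx)))

-- Here `z` pairs a position with the encoded graph. Part and slot are forgotten, since class and
-- component determine adjacency and colours.
describeᵗ : Tree → Tree
describeᵗ z =
  classᵗ (hdᵗ p) (hdᵗ (tlᵗ p)) (hdᵗ (tlᵗ (tlᵗ p))) (tlᵗ (tlᵗ (tlᵗ p))) (tlᵗ z) · tlᵗ (tlᵗ p)
  where
  p : Tree
  p = hdᵗ z

describeᵖ : PolyFun describeᵗ
describeᵖ = ⟨ classᵖ , hdᵖ ⟫ tlᵖ ⟫ tlᵖ ⟩ᵖ
  where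
  tᵖ = hdᵖ ⟫ hdᵖ
  kᵖ = hdᵖ ⟫ tlᵖ ⟫ hdᵖ
  aᵖ = hdᵖ ⟫ tlᵖ ⟫ tlᵖ ⟫ hdᵖ
  iᵖ = hdᵖ ⟫ tlᵖ ⟫ tlᵖ ⟫ tlᵖ
  classᵖ =
    ifᵖ tᵖ (ifᵖ (ltᵖ kᵖ iᵖ) (constᵖ (encClass rgt)) (constᵖ (encClass off)))
    (ifᵖ kᵖ (ifᵖ (ltᵖ kᵖ aᵖ) (constᵖ (encClass lft)) (constᵖ (encClass off)))
    (ifᵖ aᵖ (ifᵖ (dropᵖ iᵖ (dropᵖ (aᵖ ⟫ tlᵖ) tlᵖ ⟫ hdᵖ) ⟫ hdᵖ) (constᵖ (encClass edg)) (constᵖ (encClass off)))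
            (constᵖ (encClass vtx))))

verticesᵗ : Tree → Tree
verticesᵗ g = mapᵗ describeᵗ (productᵗ (table 2 encFin) (productᵗ r⁺ (productᵗ r⁺ (rangeᵗ l)))) g
  where
  l r⁺ : Tree
  -- Erasing the rows of the adjacency matrix leaves n in unary.
  l  = mapᵗ (λ _ → nil) g nil
  r⁺ = rangeᵗ (nil · l)

verticesᵖ : PolyFun verticesᵗ
verticesᵖ = mapᵖ describeᵖ
  (productᵖ (constᵖ (table 2 encFin)) (productᵖ r⁺ (productᵖ r⁺ (rangeᵖ l)))) idᵖ
  where
  l  = mapᵖ nilᵖ idᵖ nilᵖ
  r⁺ = rangeᵖ ⟨ nilᵖ , l ⟩ᵖ

vtxᵗ edgᵗ lftᵗ rgtᵗ : Tree → Tree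
vtxᵗ d = hdᵗ (hdᵗ (hdᵗ d))
edgᵗ d = tlᵗ (hdᵗ (hdᵗ d))
lftᵗ d = hdᵗ (tlᵗ (hdᵗ d))
rgtᵗ d = tlᵗ (tlᵗ (hdᵗ d))

joinsᵗ : Tree → Tree → Tree
joinsᵗ d e = vtxᵗ d ∧ᵗ edgᵗ e ∨ᵗ ((vtxᵗ d ∨ᵗ edgᵗ d) ∧ᵗ (lftᵗ e ∨ᵗ rgtᵗ e)) ∧ᵗ
             (eqᵗ (hdᵗ (tlᵗ d)) (hdᵗ (tlᵗ e)) ∧ᵗ eqᵗ (tlᵗ (tlᵗ d)) (tlᵗ (tlᵗ e)))

joinsᵖ : PolyFun f → PolyFun g → PolyFun (λ z → joinsᵗ (f z) (g z))
joinsᵖ F G = vtxᵖ F ∧ᵖ edgᵖ G ∨ᵖ ((vtxᵖ F ∨ᵖ edgᵖ F) ∧ᵖ (lftᵖ G ∨ᵖ rgtᵖ G)) ∧ᵖ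
             (eqᵖ (F ⟫ tlᵖ ⟫ hdᵖ) (G ⟫ tlᵖ ⟫ hdᵖ) ∧ᵖ eqᵖ (F ⟫ tlᵖ ⟫ tlᵖ) (G ⟫ tlᵖ ⟫ tlᵖ))
  where
  vtxᵖ : PolyFun f → PolyFun (λ z → vtxᵗ (f z))
  vtxᵖ F = F ⟫ hdᵖ ⟫ hdᵖ ⟫ hdᵖ
  edgᵖ : PolyFun f → PolyFun (λ z → edgᵗ (f z))
  edgᵖ F = F ⟫ hdᵖ ⟫ hdᵖ ⟫ tlᵖ
  lftᵖ : PolyFun f → PolyFun (λ z → lftᵗ (f z))
  lftᵖ F = F ⟫ hdᵖ ⟫ tlᵖ ⟫ hdᵖ
  rgtᵖ : PolyFun f → PolyFun (λ z → rgtᵗ (f z))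
  rgtᵖ F = F ⟫ hdᵖ ⟫ tlᵖ ⟫ tlᵖ

-- Since `mapᵗ` supplies its parameter second, in `adjᵗ` the row vertex is `tlᵗ z` and the column
-- vertex `hdᵗ z`.
adjᵗ rowᵗ colour₁ᵗ colour₂ᵗ colouredᵗ : Tree → Tree
adjᵗ z     = joinsᵗ (tlᵗ z) (hdᵗ z) ∨ᵗ joinsᵗ (hdᵗ z) (tlᵗ z)
rowᵗ z     = mapᵗ adjᵗ (tlᵗ z) (hdᵗ z)
colour₁ᵗ z = vtxᵗ (hdᵗ z) ∨ᵗ lftᵗ (hdᵗ z)
colour₂ᵗ z = vtxᵗ (hdᵗ z) ∨ᵗ rgtᵗ (hdᵗ z)
colouredᵗ g = mapᵗ rowᵗ (verticesᵗ g) (verticesᵗ g) ·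
              mapᵗ colour₁ᵗ (verticesᵗ g) nil · mapᵗ colour₂ᵗ (verticesᵗ g) nil

colouredᵖ : PolyFun colouredᵗ
colouredᵖ = ⟨ mapᵖ rowᵖ verticesᵖ verticesᵖ ,
            ⟨ mapᵖ (vtxᵖ ∨ᵖ lftᵖ) verticesᵖ nilᵖ , mapᵖ (vtxᵖ ∨ᵖ rgtᵖ) verticesᵖ nilᵖ ⟩ᵖ ⟩ᵖ
  where
  rowᵖ = mapᵖ (joinsᵖ tlᵖ hdᵖ ∨ᵖ joinsᵖ hdᵖ tlᵖ) tlᵖ hdᵖ
  vtxᵖ = hdᵖ ⟫ hdᵖ ⟫ hdᵖ ⟫ hdᵖ
  lftᵖ = hdᵖ ⟫ hdᵖ ⟫ tlᵖ ⟫ hdᵖ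
  rgtᵖ = hdᵖ ⟫ hdᵖ ⟫ tlᵖ ⟫ tlᵖ

-- Correctness of the computation on encoded graphs

encGraph-table : ∀ G → let open Graph G in
                 encGraph G ≡ table order (λ u → table order (λ v → encBool (adj u v)))
encGraph-table G = trans (encList-tabulate encSubset order adj)
  (table-cong order (λ u → encList-tabulate encBool order (adj u)))
  where open Graph G

joinsᵗ-enc : ∀ c d a i b j →
  joinsᵗ (encClass c · encℕ a · encℕ i) (encClass d · encℕ b · encℕ j) ≡
  encBool (joins c d (does (a ≟ b) ∧ does (i ≟ j)))
joinsᵗ-enc c d a i b j
  rewrite eqᵗ-encℕ a b | eqᵗ-encℕ i j
        | ∧ᵗ-encBool (does (a ≟ b)) (does (i ≟ j))
        | ∨ᵗ-encBool (isVtx c) (isEdg c)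
        | ∨ᵗ-encBool (isLft d) (isRgt d)
        | ∧ᵗ-encBool (isCentre c) (isLeaf d)
        | ∧ᵗ-encBool (isCentre c ∧ isLeaf d) (does (a ≟ b) ∧ does (i ≟ j))
        | ∧ᵗ-encBool (isVtx c) (isEdg d) =
  ∨ᵗ-encBool (isVtx c ∧ isEdg d) ((isCentre c ∧ isLeaf d) ∧ (does (a ≟ b) ∧ does (i ≟ j)))

module _ (G : Graph) where
  open Graph G renaming (order to n)
  open Coding G hiding (coloured)

  encComponent : Component → Tree
  encComponent c = encFin (major c) · encFin (minor c)

  describe : Fin order⁺ → Tree
  describe u = encClass (class u) · encComponent (component u)

  classᵗ-correct : ∀ t k a i → classᵗ (encFin t) (encFin k) (encFin a) (encFin i) (encGraph G) ≡
                               encClass (classAt t k a i)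
  classᵗ-correct zero zero zero i = refl
  classᵗ-correct zero zero (suc b) i
    rewrite encGraph-table G
          | lookup-table n (λ u → table n (λ v → encBool (adj u v))) b
          | lookup-table n (λ v → encBool (adj b v)) i = ifᵗ-encBool encClass (adj b i) edg off
  classᵗ-correct zero k@(suc _) a i
    rewrite ltᵗ-encℕ (toℕ k) (toℕ a) = ifᵗ-encBool encClass (toℕ k <ᵇ toℕ a) lft off
  classᵗ-correct (suc _) k a i
    rewrite ltᵗ-encℕ (toℕ k) (toℕ i) = ifᵗ-encBool encClass (toℕ k <ᵇ toℕ i) rgt off

  verticesᵗ-correct : verticesᵗ (encGraph G) ≡ table order⁺ describe
  verticesᵗ-correct = begin
    verticesᵗ (encGraph G)
      ≡⟨ cong (λ l → mapᵗ describeᵗ (productᵗ (table 2 encFin) (productᵗ (rangeᵗ (nil · l))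
           (productᵗ (rangeᵗ (nil · l)) (rangeᵗ l)))) (encGraph G)) length-correct ⟩
    mapᵗ describeᵗ (productᵗ (table 2 encFin) (productᵗ (rangeᵗ (encℕ (suc n)))
      (productᵗ (rangeᵗ (encℕ (suc n))) (rangeᵗ (encℕ n))))) (encGraph G)
      ≡⟨ cong₂ (λ x y → mapᵗ describeᵗ (productᵗ (table 2 encFin) (productᵗ x (productᵗ x y))) (encGraph G))
           (rangeᵗ-encℕ (suc n)) (rangeᵗ-encℕ n) ⟩
    mapᵗ describeᵗ (productᵗ (table 2 encFin) (productᵗ (table (suc n) encFin)
      (productᵗ (table (suc n) encFin) (table n encFin)))) (encGraph G)
      ≡⟨ cong (λ x → mapᵗ describeᵗ (productᵗ (table 2 encFin) (productᵗ (table (suc n) encFin) x)) (encGraph G))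
           (productᵗ-table (suc n) n encFin encFin) ⟩
    mapᵗ describeᵗ (productᵗ (table 2 encFin) (productᵗ (table (suc n) encFin)
      (table (suc n * n) encComponent))) (encGraph G)
      ≡⟨ cong (λ x → mapᵗ describeᵗ (productᵗ (table 2 encFin) x) (encGraph G))
           (productᵗ-table (suc n) (suc n * n) encFin encComponent) ⟩
    mapᵗ describeᵗ (productᵗ (table 2 encFin) (table (suc n * (suc n * n)) _)) (encGraph G)
      ≡⟨ cong (λ x → mapᵗ describeᵗ x (encGraph G))
           (productᵗ-table 2 (suc n * (suc n * n)) encFin _) ⟩
    mapᵗ describeᵗ (table order⁺ (λ u → encFin (part u) · encFin (slot u) · encComponent (component u)))
      (encGraph G)
      ≡⟨ mapᵗ-table order⁺ describeᵗ (encGraph G) _ ⟩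
    table order⁺ _
      ≡⟨ table-cong order⁺ (λ u → cong (_· encComponent (component u))
           (classᵗ-correct (part u) (slot u) (major (component u)) (minor (component u)))) ⟩
    table order⁺ describe ∎
    where
    open ≡-Reasoning
    length-correct : mapᵗ (λ _ → nil) (encGraph G) nil ≡ encℕ n
    length-correct = trans (cong (λ x → mapᵗ (λ _ → nil) x nil) (encGraph-table G))
      (trans (mapᵗ-table n (λ _ → nil) nil _) (encℕ-table n))

  same-component : ∀ c d → does (toℕ (major c) ≟ toℕ (major d)) ∧ does (toℕ (minor c) ≟ toℕ (minor d)) ≡
                           does (c ≟ᶠ d)
  same-component c d = does-⇔ (mk⇔ to (λ { refl → refl , refl }))
    ((toℕ (major c) ≟ toℕ (major d)) ×-dec (toℕ (minor c) ≟ toℕ (minor d))) (c ≟ᶠ d)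
    where
    to : toℕ (major c) ≡ toℕ (major d) × toℕ (minor c) ≡ toℕ (minor d) → c ≡ d
    to (p , q) = trans (sym (combine-remQuot {suc n} n c))
      (trans (cong₂ combine (toℕ-injective p) (toℕ-injective q)) (combine-remQuot {suc n} n d))

  joinsᵗ-correct : ∀ u v → joinsᵗ (describe u) (describe v) ≡ encBool (joinsᵘ u v)
  joinsᵗ-correct u v = trans
    (joinsᵗ-enc (class u) (class v) (toℕ (major (component u))) (toℕ (minor (component u)))
                (toℕ (major (component v))) (toℕ (minor (component v))))
    (cong (λ s → encBool (joins (class u) (class v) s)) (same-component (component u) (component v)))

  colouredᵗ-correct : colouredᵗ (encGraph G) ≡ encColouredGraph (coloured G)
  colouredᵗ-correct rewrite verticesᵗ-correct = cong₂ _·_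
    (trans (mapᵗ-table order⁺ rowᵗ (table order⁺ describe) describe)
      (trans (table-cong order⁺ λ u → trans (mapᵗ-table order⁺ adjᵗ (describe u) describe)
        (table-cong order⁺ λ v → trans (cong₂ _∨ᵗ_ (joinsᵗ-correct u v) (joinsᵗ-correct v u))
          (∨ᵗ-encBool (joinsᵘ u v) (joinsᵘ v u))))
      (sym (encGraph-table (ColouredGraph.graph (coloured G))))))
    (cong₂ _·_ (colours colour₁ᵗ colour₁ λ u → ∨ᵗ-encBool (isVtx (class u)) (isLft (class u)))
               (colours colour₂ᵗ colour₂ λ u → ∨ᵗ-encBool (isVtx (class u)) (isRgt (class u))))
    where
    colours : ∀ (colourᵗ : Tree → Tree) (colour : Class → Bool) →
              (∀ u → colourᵗ (describe u · nil) ≡ encBool (colour (class u))) →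
              mapᵗ colourᵗ (table order⁺ describe) nil ≡ encSubset (λ u → colour (class u))
    colours colourᵗ colour correct = trans (mapᵗ-table order⁺ colourᵗ nil describe)
      (trans (table-cong order⁺ correct) (sym (encList-tabulate encBool order⁺ (λ u → colour (class u)))))

polyTime : ∀ {A B : Set} {encA : A → Tree} {encB : B → Tree} {F : A → B} →
           PolyFun f → (∀ x → f (encA x) ≡ encB (F x)) → PolyTime encA encB F
polyTime {encA = encA} P correct =
  -- One constant must serve both as factor and as exponent, hence the sum.
  program P , eval (bound P) 1 + deg (bound P) , λ x →
    let (t , d , t≤) = run P (encA x) ; s = size (encA x) ; open ≤-Reasoning in
    t , subst (λ y → program P ⊢ encA x ⇓ y [ t ]) (correct x) d , (begin
      t                                      ≤⟨ t≤ ⟩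
      eval (bound P) s                       ≡⟨ cong (eval (bound P)) (*-identityˡ s) ⟨
      eval (bound P) (1 * s)                 ≤⟨ eval-* (bound P) 1 ⟩
      eval (bound P) 1 * s ^ deg (bound P)   ≤⟨ *-mono-≤ (m≤m+n (eval (bound P) 1) (deg (bound P)))
                                                 (^-monoʳ-≤ s (m≤n+m (deg (bound P)) (eval (bound P) 1))) ⟩
      (eval (bound P) 1 + deg (bound P)) * s ^ (eval (bound P) 1 + deg (bound P)) ∎)

-- Shrub-depth

-- The tree has the root 0, one child of the root for each component, and the vertices
-- as leaves below their components.
module ComponentTree {M : ℕ} (H : Graph) (component : Graph.V H → Fin M)
                     (inhabited : ∀ c → ∃[ v ] component v ≡ c) where
  open Graph H renaming (order to N)

  Nodeᶜ : Set
  Nodeᶜ = Fin (suc (M + N))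

  inner : Fin M → Nodeᶜ
  inner c = suc (c ↑ˡ N)

  leafᶜ : V → Nodeᶜ
  leafᶜ v = suc (M ↑ʳ v)

  parentᶜ : Nodeᶜ → Maybe Nodeᶜ
  parentᶜ zero    = nothing
  parentᶜ (suc x) = [ (λ _ → just zero) , (λ v → just (inner (component v))) ]′ (splitAt M x)

  parent-inner : ∀ c → parentᶜ (inner c) ≡ just zero
  parent-inner c rewrite splitAt-↑ˡ M c N = refl

  parent-leaf : ∀ v → parentᶜ (leafᶜ v) ≡ just (inner (component v))
  parent-leaf v rewrite splitAt-↑ʳ M N v = refl

  data NodeView : Nodeᶜ → Set where
    rootⱽ  : NodeView zero
    innerⱽ : ∀ c → NodeView (inner c)
    leafⱽ  : ∀ v → NodeView (leafᶜ v)

  view : ∀ x → NodeView x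
  view zero    = rootⱽ
  view (suc x) = subst (λ y → NodeView (suc y)) (join-splitAt M N x) (viewˢ (splitAt M x))
    where
    viewˢ : ∀ s → NodeView (suc ([ _↑ˡ N , M ↑ʳ_ ]′ s))
    viewˢ (inj₁ c) = innerⱽ c
    viewˢ (inj₂ v) = leafⱽ v

  path-inner : ∀ c → Path (λ x y → parentᶜ y ≡ just x) zero (inner c) 1
  path-inner c = parent-inner c ∷ []

  path-leaf : ∀ v → Path (λ x y → parentᶜ y ≡ just x) zero (leafᶜ v) 2
  path-leaf v = parent-inner (component v) ∷ parent-leaf v ∷ []

  tree : RootedTree
  tree = record
    { size        = suc (M + N)
    ; root        = zero
    ; parent      = parentᶜ
    ; root-orphan = refl
    ; reachable   = λ x → reach (view x)
    }
    where
    reach : ∀ {x} → NodeView x → ∃[ k ] Path (λ x y → parentᶜ y ≡ just x) zero x k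
    reach rootⱽ      = 0 , []
    reach (innerⱽ c) = 1 , path-inner c
    reach (leafⱽ v)  = 2 , path-leaf v

  open RootedTree tree using (Child; Descent; IsLeaf; Walk; Distance)

  inner-injective : ∀ {c d} → inner c ≡ inner d → c ≡ d
  inner-injective eq = ↑ˡ-injective N _ _ (suc-injective eq)

  leaf-injective : ∀ {u v} → leafᶜ u ≡ leafᶜ v → u ≡ v
  leaf-injective eq = ↑ʳ-injective M _ _ (suc-injective eq)

  just-unique : ∀ {x : Maybe Nodeᶜ} {y z} → x ≡ just y → x ≡ just z → y ≡ z
  just-unique p q = just-injective (trans (sym p) q)

  inner≢leaf : ∀ {c v} → inner c ≢ leafᶜ v
  inner≢leaf {c} {v} eq = contradiction
    (trans (sym (splitAt-↑ˡ M c N)) (trans (cong (splitAt M) (suc-injective eq)) (splitAt-↑ʳ M N v)))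
    λ ()

  leaf-childless : ∀ v → IsLeaf (leafᶜ v)
  leaf-childless v y child with view y
  ... | rootⱽ    = contradiction child λ ()
  ... | innerⱽ c = contradiction (just-unique (parent-inner c) child) λ ()
  ... | leafⱽ w  = inner≢leaf (just-unique (parent-leaf w) child)

  is-leaf : ∀ x → IsLeaf x ⇔ (∃[ v ] leafᶜ v ≡ x)
  is-leaf x = mk⇔ (to (view x)) λ { (v , refl) → leaf-childless v }
    where
    -- Without a vertex the root itself would be a leaf.
    aVertex : Fin N
    aVertex with N | nonEmpty
    ... | suc _ | _ = zero
    to : ∀ {x} → NodeView x → IsLeaf x → ∃[ v ] leafᶜ v ≡ x
    to rootⱽ      childless = contradiction (parent-inner (component aVertex)) (childless _)
    -- An empty component would turn its inner node into a leaf that stands for no vertex.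
    to (innerⱽ c) childless = let (v , v∈c) = inhabited c in
      contradiction (trans (parent-leaf v) (cong (just ∘ inner) v∈c)) (childless _)
    to (leafⱽ v)  childless = v , refl

  leaf-depth : ∀ v k → Descent zero (leafᶜ v) k → k ≡ 2
  leaf-depth v _ = fromRoot refl
    where
    -- The end points are variables tied down by equations, because the empty path cannot be matched
    -- against two computed nodes.
    fromLeaf : ∀ {w x y k} → x ≡ leafᶜ w → Descent x y k → k ≡ 0
    fromLeaf _    []                = refl
    fromLeaf refl (_∷_ {y = z} p _) = contradiction p (leaf-childless _ z)

    fromInner : ∀ {c x y k} → x ≡ inner c → y ≡ leafᶜ v → Descent x y k → k ≡ 1
    fromInner x≡ y≡ [] = contradiction (trans (sym x≡) y≡) inner≢leaf
    fromInner x≡ y≡ (_∷_ {y = z} p path) with view z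
    ... | rootⱽ    = contradiction p λ ()
    ... | innerⱽ d = contradiction (trans (just-unique (parent-inner d) p) x≡) λ ()
    ... | leafⱽ w  = cong suc (fromLeaf refl path)

    fromRoot : ∀ {y k} → y ≡ leafᶜ v → Descent zero y k → k ≡ 2
    fromRoot y≡ [] = contradiction y≡ λ ()
    fromRoot y≡ (_∷_ {y = z} p path) with view z
    ... | rootⱽ    = contradiction p λ ()
    ... | innerⱽ d = cong suc (fromInner refl y≡ path)
    ... | leafⱽ w  = contradiction (just-unique (parent-leaf w) p) λ ()

  walk-0 : ∀ {u v} → Walk (leafᶜ u) (leafᶜ v) 0 → u ≡ v
  walk-0 w = leaf-injective (go w)
    where
    go : ∀ {x y} → Walk x y 0 → x ≡ y
    go [] = refl

  ¬walk-1 : ∀ {u v} → ¬ Walk (leafᶜ u) (leafᶜ v) 1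
  ¬walk-1 {u} {v} (inj₁ p ∷ []) = leaf-childless u _ p
  ¬walk-1 {u} {v} (inj₂ p ∷ []) = leaf-childless v _ p

  -- A leaf can only be left upwards and entered downwards, so the middle node is a common parent.
  walk-2⁻ : ∀ {u v} → Walk (leafᶜ u) (leafᶜ v) 2 → component u ≡ component v
  walk-2⁻ {u} {v} (_∷_ {y = z} (inj₁ p) _)             = contradiction p (leaf-childless u z)
  walk-2⁻ {u} {v} (_∷_ {y = z} (inj₂ p) (inj₂ q ∷ [])) = contradiction q (leaf-childless v z)
  walk-2⁻ {u} {v} (inj₂ p ∷ inj₁ q ∷ [])               =
    inner-injective (trans (just-unique (parent-leaf u) p) (sym (just-unique (parent-leaf v) q)))

  walk-2⁺ : ∀ {u v} → component u ≡ component v → Walk (leafᶜ u) (leafᶜ v) 2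
  walk-2⁺ {u} {v} eq =
    inj₂ (parent-leaf u) ∷ inj₁ (trans (parent-leaf v) (cong (just ∘ inner) (sym eq))) ∷ []

  -- Distinct leaves are never at distance 0 or 1, so a walk of length 2 is automatically shortest.
  -- The test for 2 thus recovers the flag of the edge rule from the distance.
  distance-2 : ∀ {u v k} → u ≢ v → Distance (leafᶜ u) (leafᶜ v) k → component u ≡ component v ⇔ k ≡ 2
  distance-2 {u} {v} {k} u≢v (walk , shortest) = mk⇔
    (λ eq → to walk (shortest 2 (walk-2⁺ eq)))
    (λ { refl → walk-2⁻ walk })
    where
    to : ∀ {k} → Walk (leafᶜ u) (leafᶜ v) k → k ≤ 2 → k ≡ 2
    to {0} w _ = contradiction (walk-0 w) u≢v
    to {1} w _ = contradiction w ¬walk-1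
    to {2} w _ = refl
    to {suc (suc (suc _))} w (s≤s (s≤s ()))

  treeModel : ∀ {m} (label : V → Fin m) (rule : Fin m → Fin m → Bool → Bool) →
              (∀ u v → adj u v ≡ rule (label u) (label v) (does (component u ≟ᶠ component v))) →
              TreeModel 2 m H
  treeModel label rule adj-rule = record
    { tree      = tree
    ; leaf      = leafᶜ
    ; leaf-inj  = leaf-injective
    ; leaves    = is-leaf
    ; depth     = leaf-depth
    ; label     = label
    ; edge-rule = λ i j k → rule i j (does (k ≟ 2))
    ; edges     = λ u v k u≢v dist → trans (adj-rule u v)
        (cong (rule (label u) (label v))
          (does-⇔ (distance-2 u≢v dist) (component u ≟ᶠ component v) (k ≟ 2)))
    }

-- Admitting every graph with such a model, instead of only the constructed ones, makes the
-- shrub-depth bound immediate. The five labels are the classes.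
LabelledDepth2 : ColouredGraph → Set
LabelledDepth2 G = TreeModel 2 5 (ColouredGraph.graph G)

shrubDepth : ShrubDepth≤ 2 (Reducts LabelledDepth2)
shrubDepth = 5 , λ { H (G , model , refl) → model }

module _ (G : Graph) where
  open Graph G renaming (order to n)
  open Coding G hiding (coloured)

  at : Fin 2 → Fin (suc n) → Component → Fin order⁺
  at t k c = combine t (combine k c)

  remQuot-at : ∀ {A : Set} (h : Fin 2 → Fin (suc n) → Component → A) t k c →
               h (part (at t k c)) (slot (at t k c)) (component (at t k c)) ≡ h t k c
  remQuot-at h t k c = trans
    (cong (λ { (t , r) → h t (proj₁ (remQuot (suc n * n) r)) (proj₂ (remQuot {suc n} (suc n * n) r)) })
      (remQuot-combine t (combine k c)))
    (cong (λ { (k , c) → h t k c }) (remQuot-combine k c))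

  class-at : ∀ t k c → class (at t k c) ≡ classIn t k c
  class-at = remQuot-at classIn

  component-at : ∀ t k c → component (at t k c) ≡ c
  component-at = remQuot-at (λ t k c → c)

  coloured-labelled : LabelledDepth2 (coloured G)
  coloured-labelled = ComponentTree.treeModel (ColouredGraph.graph (coloured G)) component
    (λ c → at zero zero c , component-at zero zero c) class joinsˢ adj⁺-rule

-- Counting

χ : Bool → ℕ
χ b = if b then 1 else 0

sum-zero : ∀ n {f : Fin n → ℕ} → (∀ i → f i ≡ 0) → sum f ≡ 0
sum-zero n f≡0 = trans (sum-cong-≗ f≡0) (sum-replicate-zero n)

sum-↑ : ∀ m k (f : Fin (m + k) → ℕ) → sum f ≡ sum (λ i → f (i ↑ˡ k)) + sum (λ j → f (m ↑ʳ j))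
sum-↑ zero    k f = refl
sum-↑ (suc m) k f = trans (cong (λ s → f zero + s) (sum-↑ m k (f ∘ suc))) (sym (+-assoc (f zero) _ _))

sum-combine : ∀ m k (f : Fin (m * k) → ℕ) → sum f ≡ sum {m} (λ i → sum {k} (λ j → f (combine i j)))
sum-combine zero    k f = refl
sum-combine (suc m) k f = trans (sum-↑ k (m * k) f)
  (cong (λ s → sum (λ j → f (j ↑ˡ (m * k))) + s) (sum-combine m k (λ u → f (k ↑ʳ u))))

sum-remQuot : ∀ m k (h : Fin m → Fin k → ℕ) →
  sum (λ u → h (proj₁ (remQuot k u)) (proj₂ (remQuot {m} k u))) ≡ sum (λ i → sum (h i))
sum-remQuot m k h = trans (sum-combine m k _) (sum-cong-≗ λ i → sum-cong-≗ λ j →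
  cong (λ (i , j) → h i j) (remQuot-combine i j))

-- Collapses a sum over all components to the star of one centre.
sum-δ : ∀ n (p : Fin n → Bool) c → sum (λ d → χ (p d ∧ does (c ≟ᶠ d))) ≡ χ (p c)
sum-δ (suc n) p zero    = trans
  (cong₂ (λ b s → χ b + s) (∧-identityʳ (p zero))
         (sum-zero n λ d → cong χ (∧-zeroʳ (p (suc d)))))
  (+-identityʳ _)
sum-δ (suc n) p (suc c) = cong₂ (λ b s → χ b + s) (∧-zeroʳ (p zero)) (sum-δ n (p ∘ suc) c)

sum-<ᵇ : ∀ {n m} → m ≤ n → sum {n} (λ k → χ (toℕ k <ᵇ m)) ≡ m
sum-<ᵇ {n} {zero}      m≤n       = sum-zero n (λ k → refl)
sum-<ᵇ {suc n} {suc m} (s≤s m≤n) = cong suc (sum-<ᵇ m≤n)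

-- Logic

does⁻ : ∀ {P : Set} (p? : Dec P) → does p? ≡ true → P
does⁻ (yes p) _ = p

⇔⇒≡ : ∀ {a b} → (a ≡ true ⇔ b ≡ true) → a ≡ b
⇔⇒≡ {false} {false} eq = refl
⇔⇒≡ {false} {true}  eq = Equivalence.from eq refl
⇔⇒≡ {true}  {false} eq = sym (Equivalence.to eq refl)
⇔⇒≡ {true}  {true}  eq = refl

any-allFin : ∀ {n} {p : Fin n → Bool} → any p (allFin n) ≡ true ⇔ (∃[ i ] p i ≡ true)
any-allFin {n} {p} = mk⇔
  (λ eq → let (i , _ , pi) = find (any⁻ p (allFin n) (Equivalence.from T-≡ eq)) in
    i , Equivalence.to T-≡ pi)
  (λ { (i , pi) → Equivalence.to T-≡ (any⁺ p (lose (∈-allFin i) (Equivalence.from T-≡ pi))) })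

-- Turns counting of 1-tuples into a sum of indicators; the tabulated `f` generalises `allFin` for
-- the induction.
length-filter-tuples : ∀ {N n} (p : Vec (Fin N) 1 → Bool) (f : Fin n → Fin N) →
  length (filterᵇ p (concatMap (λ v → List.map (v ∷_) (allTuples N 0)) (List.tabulate f))) ≡
  sum (λ i → χ (p (f i ∷ [])))
length-filter-tuples {n = zero}  p f = refl
length-filter-tuples {n = suc n} p f with p (f zero ∷ [])
... | true  = cong suc (length-filter-tuples p (f ∘ suc))
... | false = length-filter-tuples p (f ∘ suc)

-- The interpreting formulas and the classes they define

infixr 6 _∧ᶠ_
_∧ᶠ_ : ∀ {n} → L₁.Formula n → L₁.Formula n → L₁.Formula n
φ ∧ᶠ ψ = L₁.neg (L₁.or (L₁.neg φ) (L₁.neg ψ))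

not-∨-not : ∀ a b → not (not a ∨ not b) ≡ a ∧ b
not-∨-not false b     = refl
not-∨-not true  false = refl
not-∨-not true  true  = refl

-- #y.(E(x,y) ∧ ψ(y)), where y is the variable 0 of ψ.
#neighbours : L₁.Formula 2 → L₁.Term 1
#neighbours ψ = L₁.count 1 (L₁.edge (suc zero) zero ∧ᶠ ψ)

lft-leaf rgt-leaf : L₁.Formula 2
lft-leaf = L₁.C₁ zero ∧ᶠ L₁.neg (L₁.C₂ zero)
rgt-leaf = L₁.C₂ zero ∧ᶠ L₁.neg (L₁.C₁ zero)

φⱽ : ∀ {n} → Fin n → L₁.Formula n
φⱽ x = L₁.C₁ x ∧ᶠ L₁.C₂ x

-- Uncoloured vertices have class `edg` or `off`, and the edge demanded by the comparison with `x`
-- rules out `off`. The number of `x` is matched with the first entry of the ordered pair, that of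
-- `y` with the second.
φᴱ : ∀ {n} → Fin n → Fin n → L₁.Formula n
φᴱ x y = L₁.ex (L₁.neg (L₁.or (L₁.C₁ zero) (L₁.C₂ zero)) ∧ᶠ
  L₁.edge-P₌ (suc x) zero (#neighbours rgt-leaf) (#neighbours lft-leaf) ∧ᶠ
  L₁.edge-P₌ (suc y) zero (#neighbours rgt-leaf) (#neighbours rgt-leaf))

#neighbours-sum : ∀ H (ψ : L₁.Formula 2) x → let open ColouredGraph H in
  L₁.⟦_⟧ᵗ H (#neighbours ψ) (x ∷ []) ≡ + sum (λ u → χ (adj x u ∧ L₁.⟦_⟧ H ψ (u ∷ x ∷ [])))
#neighbours-sum H ψ x = cong +_ (trans (length-filter-tuples
  (λ vs → L₁.⟦_⟧ H (L₁.edge (suc zero) zero ∧ᶠ ψ) (vs Vec.++ x ∷ [])) (λ u → u))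
  (sum-cong-≗ λ u → cong χ (not-∨-not (adj x u) (L₁.⟦_⟧ H ψ (u ∷ x ∷ [])))))
  where open ColouredGraph H

isLft-colours : ∀ c → not (not (colour₁ c) ∨ not (not (colour₂ c))) ≡ isLft c
isLft-colours vtx = refl
isLft-colours edg = refl
isLft-colours lft = refl
isLft-colours rgt = refl
isLft-colours off = refl

isRgt-colours : ∀ c → not (not (colour₂ c) ∨ not (not (colour₁ c))) ≡ isRgt c
isRgt-colours vtx = refl
isRgt-colours edg = refl
isRgt-colours lft = refl
isRgt-colours rgt = refl
isRgt-colours off = refl

isVtx-colours : ∀ c → not (not (colour₁ c) ∨ not (colour₂ c)) ≡ isVtx c
isVtx-colours vtx = refl
isVtx-colours edg = refl
isVtx-colours lft = refl
isVtx-colours rgt = refl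
isVtx-colours off = refl

joinsˢ-vtx : ∀ d s → joinsˢ vtx d s ≡ true → colour₁ d ∨ colour₂ d ≡ false → d ≡ edg
joinsˢ-vtx edg s _ _ = refl
joinsˢ-vtx off s () _

-- Only edges between centres ignore components, so the leaves adjacent to a centre are exactly
-- those of its own star.
joinsˢ-isLft : ∀ c d s → isCentre c ≡ true → joinsˢ c d s ∧ isLft d ≡ isLft d ∧ s
joinsˢ-isLft vtx lft false _ = refl
joinsˢ-isLft vtx lft true  _ = refl
joinsˢ-isLft edg lft false _ = refl
joinsˢ-isLft edg lft true  _ = refl
joinsˢ-isLft c   vtx s     _ = ∧-zeroʳ _
joinsˢ-isLft c   edg s     _ = ∧-zeroʳ _
joinsˢ-isLft c   rgt s     _ = ∧-zeroʳ _
joinsˢ-isLft c   off s     _ = ∧-zeroʳ _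

joinsˢ-isRgt : ∀ c d s → isCentre c ≡ true → joinsˢ c d s ∧ isRgt d ≡ isRgt d ∧ s
joinsˢ-isRgt vtx rgt false _ = refl
joinsˢ-isRgt vtx rgt true  _ = refl
joinsˢ-isRgt edg rgt false _ = refl
joinsˢ-isRgt edg rgt true  _ = refl
joinsˢ-isRgt c   vtx s     _ = ∧-zeroʳ _
joinsˢ-isRgt c   edg s     _ = ∧-zeroʳ _
joinsˢ-isRgt c   lft s     _ = ∧-zeroʳ _
joinsˢ-isRgt c   off s     _ = ∧-zeroʳ _

-- Correctness of the interpretation

module Interpretation (G : Graph) where
  open Graph G renaming (order to n)
  open Coding G hiding (coloured)

  private
    G⁺ : ColouredGraph
    G⁺ = coloured G

  leaves : (Class → Bool) → Fin (suc n) → Fin n → ℕ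
  leaves q a i = sum {2} (λ t → sum (λ k → χ (q (classAt t k a i))))

  leaves-lft : ∀ b i → leaves isLft (suc b) i ≡ toℕ b
  leaves-lft b i = trans
    (cong₂ (λ x y → x + (y + 0)) part₀ (sum-zero (suc n) part₁)) (+-identityʳ _)
    where
    part₀ : sum (λ k → χ (isLft (classAt zero k (suc b) i))) ≡ toℕ b
    -- Behind the centre there are n slots, and b < n ensures that all b leaves fit.
    part₀ = cong₂ _+_ centre (trans (sum-cong-≗ leaf) (sum-<ᵇ (<⇒≤ (toℕ<n b))))
      where
      centre : χ (isLft (classAt zero zero (suc b) i)) ≡ 0
      centre with adj b i
      ... | true  = refl
      ... | false = refl
      leaf : ∀ k → χ (isLft (classAt zero (suc k) (suc b) i)) ≡ χ (toℕ k <ᵇ toℕ b)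
      leaf k with toℕ k <ᵇ toℕ b
      ... | true  = refl
      ... | false = refl
    part₁ : ∀ k → χ (isLft (classAt (suc zero) k (suc b) i)) ≡ 0
    part₁ k with toℕ k <ᵇ toℕ i
    ... | true  = refl
    ... | false = refl

  leaves-rgt : ∀ a i → leaves isRgt a i ≡ toℕ i
  leaves-rgt a i = trans
    (cong₂ (λ x y → x + (y + 0)) (sum-zero (suc n) (part₀ a))
      (trans (sum-cong-≗ part₁) (sum-<ᵇ (<⇒≤ (m<n⇒m<1+n (toℕ<n i))))))
    (+-identityʳ _)
    where
    part₀ : ∀ a k → χ (isRgt (classAt zero k a i)) ≡ 0
    part₀ zero    zero = refl
    part₀ (suc b) zero with adj b i
    ... | true  = refl
    ... | false = refl
    part₀ a (suc k) with toℕ (suc k) <ᵇ toℕ a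
    ... | true  = refl
    ... | false = refl
    part₁ : ∀ k → χ (isRgt (classAt (suc zero) k a i)) ≡ χ (toℕ k <ᵇ toℕ i)
    part₁ k with toℕ k <ᵇ toℕ i
    ... | true  = refl
    ... | false = refl

  module _ (q : Class → Bool)
           (joinsˢ-q : ∀ c d s → isCentre c ≡ true → joinsˢ c d s ∧ q d ≡ q d ∧ s)
           (ψ : L₁.Formula 2) (⟦ψ⟧ : ∀ u x → L₁.⟦_⟧ G⁺ ψ (u ∷ x ∷ []) ≡ q (class u)) where

    -- By `joinsˢ-q` the counted neighbours are the positions of kind `q` in the component of `x`.
    -- Splitting the sum by coordinates leaves the component innermost, where `sum-δ` applies.
    #neighbours-centre : ∀ x → isCentre (class x) ≡ true →
      L₁.⟦_⟧ᵗ G⁺ (#neighbours ψ) (x ∷ []) ≡ + leaves q (major (component x)) (minor (component x))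
    #neighbours-centre x x-centre = trans (#neighbours-sum G⁺ ψ x) (cong +_ (begin
      sum (λ u → χ (adj⁺ x u ∧ L₁.⟦_⟧ G⁺ ψ (u ∷ x ∷ [])))
        ≡⟨ sum-cong-≗ (λ u → cong χ (trans (cong₂ _∧_ (adj⁺-rule x u) (⟦ψ⟧ u x))
             (joinsˢ-q (class x) (class u) _ x-centre))) ⟩
      sum total
        ≡⟨ sum-remQuot 2 (suc n * (suc n * n)) inner ⟩
      sum {2} (λ t → sum (inner t))
        ≡⟨ sum-cong-≗ {2} (λ t → sum-remQuot (suc n) (suc n * n) (term t)) ⟩
      sum {2} (λ t → sum {suc n} (λ k → sum (term t k)))
        ≡⟨ sum-cong-≗ {2} (λ t → sum-cong-≗ {suc n} λ k →
             sum-δ (suc n * n) (λ c → q (classIn t k c)) (component x)) ⟩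
      leaves q (major (component x)) (minor (component x)) ∎))
      where
      open ≡-Reasoning
      term : Fin 2 → Fin (suc n) → Component → ℕ
      term t k c = χ (q (classIn t k c) ∧ does (component x ≟ᶠ c))
      total : Fin order⁺ → ℕ
      total u = term (part u) (slot u) (component u)
      inner : Fin 2 → Fin (suc n * (suc n * n)) → ℕ
      inner t r = term t (proj₁ (remQuot (suc n * n) r)) (proj₂ (remQuot {suc n} (suc n * n) r))

  #lft≡ : ∀ x {b} → isCentre (class x) ≡ true → major (component x) ≡ suc b →
          L₁.⟦_⟧ᵗ G⁺ (#neighbours lft-leaf) (x ∷ []) ≡ + toℕ b
  #lft≡ x {b} x-centre major≡ = trans
    (#neighbours-centre isLft joinsˢ-isLft lft-leaf (λ u _ → isLft-colours (class u)) x x-centre)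
    (cong +_ (trans (cong (λ a → leaves isLft a (minor (component x))) major≡) (leaves-lft b _)))

  #rgt≡ : ∀ x → isCentre (class x) ≡ true →
          L₁.⟦_⟧ᵗ G⁺ (#neighbours rgt-leaf) (x ∷ []) ≡ + toℕ (minor (component x))
  #rgt≡ x x-centre = trans
    (#neighbours-centre isRgt joinsˢ-isRgt rgt-leaf (λ u _ → isRgt-colours (class u)) x x-centre)
    (cong +_ (leaves-rgt (major (component x)) (minor (component x))))

  n≤order⁺ : n ≤ order⁺
  n≤order⁺ = ≤-trans (m≤m+n n (n * n)) (≤-trans (m≤m+n (suc n * n) (n * (suc n * n)))
    (m≤m+n (suc n * (suc n * n)) _))

  ι : V → Fin order⁺
  ι v = inject≤ v n≤order⁺

  -- With all other coordinates zero, `combine` only embeds initial segments, so the number of the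
  -- position is that of `v`.
  ι-at : ∀ v → ι v ≡ at G zero zero (combine {suc n} zero v)
  ι-at v = toℕ-injective (begin
    toℕ (ι v)                                            ≡⟨ toℕ-inject≤ v n≤order⁺ ⟩
    toℕ v                                                ≡⟨ toℕ-↑ˡ v (n * n) ⟨
    toℕ (v ↑ˡ (n * n))
      ≡⟨ toℕ-↑ˡ (v ↑ˡ (n * n)) (n * (suc n * n)) ⟨
    toℕ ((v ↑ˡ (n * n)) ↑ˡ (n * (suc n * n)))
      ≡⟨ toℕ-↑ˡ ((v ↑ˡ (n * n)) ↑ˡ (n * (suc n * n))) (1 * (suc n * (suc n * n))) ⟨
    toℕ (at G zero zero (combine {suc n} zero v))                ∎)
    where open ≡-Reasoning

  classIn-combine : ∀ t k a i → classIn t k (combine a i) ≡ classAt t k a i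
  classIn-combine t k a i = cong (λ (a , i) → classAt t k a i) (remQuot-combine a i)

  class-ι : ∀ v → class (ι v) ≡ vtx
  class-ι v = trans (cong class (ι-at v)) (trans (class-at G zero zero (combine {suc n} zero v))
    (classIn-combine zero zero zero v))

  minor-ι : ∀ v → minor (component (ι v)) ≡ v
  minor-ι v = trans (cong (λ u → minor (component u)) (ι-at v))
    (trans (cong minor (component-at G zero zero (combine {suc n} zero v)))
           (cong proj₂ (remQuot-combine {suc n} zero v)))

  at-position : ∀ u → at G (part u) (slot u) (component u) ≡ u
  at-position u = trans
    (cong (combine (part u)) (combine-remQuot {suc n} (suc n * n) (proj₂ (remQuot {2} _ u))))
    (combine-remQuot {2} (suc n * (suc n * n)) u)

  isVtx⁻ : ∀ t k a i → isVtx (classAt t k a i) ≡ true → t ≡ zero × k ≡ zero × a ≡ zero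
  isVtx⁻ zero zero zero i eq = refl , refl , refl
  isVtx⁻ zero zero (suc b) i eq with adj b i
  isVtx⁻ zero zero (suc b) i () | true
  isVtx⁻ zero zero (suc b) i () | false
  isVtx⁻ zero k@(suc _) a i eq with toℕ k <ᵇ toℕ a
  isVtx⁻ zero k@(suc _) a i () | true
  isVtx⁻ zero k@(suc _) a i () | false
  isVtx⁻ (suc zero) k a i eq with toℕ k <ᵇ toℕ i
  isVtx⁻ (suc zero) k a i () | true
  isVtx⁻ (suc zero) k a i () | false

  edg⁻ : ∀ t k a i → classAt t k a i ≡ edg → ∃[ b ] (a ≡ suc b × adj b i ≡ true)
  edg⁻ zero zero (suc b) i eq with adj b i in adj≡
  edg⁻ zero zero (suc b) i eq | true = b , refl , adj≡
  edg⁻ zero zero (suc b) i () | false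
  edg⁻ zero k@(suc _) a i eq with toℕ k <ᵇ toℕ a
  edg⁻ zero k@(suc _) a i () | true
  edg⁻ zero k@(suc _) a i () | false
  edg⁻ (suc zero) k a i eq with toℕ k <ᵇ toℕ i
  edg⁻ (suc zero) k a i () | true
  edg⁻ (suc zero) k a i () | false

  φⱽ-correct : ∀ {m} (x : Fin m) ρ → L₁.⟦_⟧ G⁺ (φⱽ x) ρ ≡ true ⇔ (∃[ v ] lookup ρ x ≡ ι v)
  φⱽ-correct x ρ = mk⇔ to from
    where
    u = lookup ρ x
    to : L₁.⟦_⟧ G⁺ (φⱽ x) ρ ≡ true → ∃[ v ] u ≡ ι v
    to eq = minor (component u) , (begin
      u                                           ≡⟨ at-position u ⟨
      at G (part u) (slot u) (component u)
        ≡⟨ cong₂ (λ t k → at G t k (component u)) t≡0 k≡0 ⟩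
      at G zero zero (component u)
        ≡⟨ cong (at G zero zero) (combine-remQuot {suc n} n (component u)) ⟨
      at G zero zero (combine (major (component u)) (minor (component u)))
        ≡⟨ cong (λ a → at G zero zero (combine a (minor (component u)))) a≡0 ⟩
      at G zero zero (combine {suc n} zero (minor (component u)))
        ≡⟨ ι-at (minor (component u)) ⟨
      ι (minor (component u)) ∎)
      where
      open ≡-Reasoning
      position = isVtx⁻ (part u) (slot u) _ _ (trans (sym (isVtx-colours (class u))) eq)
      t≡0 = proj₁ position
      k≡0 = proj₁ (proj₂ position)
      a≡0 = proj₂ (proj₂ position)
    from : (∃[ v ] u ≡ ι v) → L₁.⟦_⟧ G⁺ (φⱽ x) ρ ≡ true
    from (v , u≡) = trans (isVtx-colours (class u)) (cong isVtx (trans (cong class u≡) (class-ι v)))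

  private
    #lft #rgt : Fin order⁺ → ℤ
    #lft x = L₁.⟦_⟧ᵗ G⁺ (#neighbours lft-leaf) (x ∷ [])
    #rgt x = L₁.⟦_⟧ᵗ G⁺ (#neighbours rgt-leaf) (x ∷ [])

  -- Undoes the De Morgan form of the conjunctions below the quantifier.
  φᴱ-matrix : ∀ {m} (x y : Fin m) ρ → L₁.⟦_⟧ G⁺ (φᴱ x y) ρ ≡ true ⇔
    (∃[ w ] (not (colour₁ (class w) ∨ colour₂ (class w)) ∧
             (adj⁺ (lookup ρ x) w ∧ does (#rgt (lookup ρ x) ≟ℤ #lft w)) ∧
             (adj⁺ (lookup ρ y) w ∧ does (#rgt (lookup ρ y) ≟ℤ #rgt w)) ≡ true))
  φᴱ-matrix x y ρ = mk⇔
    (λ eq → let (w , p) = Equivalence.to any-allFin eq in w , trans (sym (matrix w)) p)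
    (λ (w , p) → Equivalence.from any-allFin (w , trans (matrix w) p))
    where
    matrix : ∀ w → _ ≡ _
    matrix w = trans
      (not-∨-not (not (colour₁ (class w) ∨ colour₂ (class w))) _)
      (cong (not (colour₁ (class w) ∨ colour₂ (class w)) ∧_)
        (not-∨-not (adj⁺ (lookup ρ x) w ∧ does (#rgt (lookup ρ x) ≟ℤ #lft w)) _))

  adj⁺-ι : ∀ {u} v w → u ≡ ι v → adj⁺ u w ≡ joinsˢ vtx (class w) (does (component u ≟ᶠ component w))
  adj⁺-ι {u} v w u≡ = trans (adj⁺-rule u w)
    (cong (λ c → joinsˢ c (class w) (does (component u ≟ᶠ component w)))
         (trans (cong class u≡) (class-ι v)))

  #rgt-ι : ∀ {u} v → u ≡ ι v → #rgt u ≡ + toℕ v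
  #rgt-ι v refl = trans (#rgt≡ (ι v) (cong isCentre (class-ι v))) (cong (λ i → + toℕ i) (minor-ι v))

  φᴱ-correct : ∀ {m} (x y : Fin m) ρ {u v} → lookup ρ x ≡ ι u → lookup ρ y ≡ ι v →
               L₁.⟦_⟧ G⁺ (φᴱ x y) ρ ≡ true ⇔ adj u v ≡ true
  φᴱ-correct x y ρ {u} {v} x≡ y≡ = mk⇔ to from
    where
    to : L₁.⟦_⟧ G⁺ (φᴱ x y) ρ ≡ true → adj u v ≡ true
    to eq = subst₂ (λ u v → adj u v ≡ true) (sym u≡b) (sym v≡i) b~i
      where
      found = Equivalence.to (φᴱ-matrix x y ρ) eq
      w = proj₁ found
      uncoloured = ∧-conicalˡ (not (colour₁ (class w) ∨ colour₂ (class w))) _ (proj₂ found)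
      rest = ∧-conicalʳ (not (colour₁ (class w) ∨ colour₂ (class w))) _ (proj₂ found)
      x-part = ∧-conicalˡ (adj⁺ (lookup ρ x) w ∧ does (#rgt (lookup ρ x) ≟ℤ #lft w)) _ rest
      y-part = ∧-conicalʳ (adj⁺ (lookup ρ x) w ∧ does (#rgt (lookup ρ x) ≟ℤ #lft w)) _ rest
      class≡edg : class w ≡ edg
      class≡edg = joinsˢ-vtx (class w) _
        (trans (sym (adj⁺-ι u w x≡)) (∧-conicalˡ (adj⁺ (lookup ρ x) w) _ x-part))
        (trans (sym (not-involutive _)) (cong not uncoloured))
      w-centre = cong isCentre class≡edg
      pair = edg⁻ (part w) (slot w) (major (component w)) (minor (component w)) class≡edg
      b = proj₁ pair
      b~i = proj₂ (proj₂ pair)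
      u≡b : u ≡ b
      u≡b = toℕ-injective (+-injective (trans (sym (#rgt-ι u x≡)) (trans
        (does⁻ (#rgt (lookup ρ x) ≟ℤ #lft w) (∧-conicalʳ (adj⁺ (lookup ρ x) w) _ x-part))
        (#lft≡ w w-centre (proj₁ (proj₂ pair))))))
      v≡i : v ≡ minor (component w)
      v≡i = toℕ-injective (+-injective (trans (sym (#rgt-ι v y≡)) (trans
        (does⁻ (#rgt (lookup ρ y) ≟ℤ #rgt w) (∧-conicalʳ (adj⁺ (lookup ρ y) w) _ y-part))
        (#rgt≡ w w-centre))))
    from : adj u v ≡ true → L₁.⟦_⟧ G⁺ (φᴱ x y) ρ ≡ true
    from u~v = Equivalence.from (φᴱ-matrix x y ρ) (w , cong₂ _∧_
      (cong (λ c → not (colour₁ c ∨ colour₂ c)) class≡edg)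
      (cong₂ _∧_
        (cong₂ _∧_ (adjacent u x≡) (dec-true (#rgt (lookup ρ x) ≟ℤ #lft w)
          (trans (#rgt-ι u x≡) (sym (#lft≡ w w-centre (cong proj₁ position≡))))))
        (cong₂ _∧_ (adjacent v y≡) (dec-true (#rgt (lookup ρ y) ≟ℤ #rgt w)
          (trans (#rgt-ι v y≡) (sym (trans (#rgt≡ w w-centre)
            (cong (λ p → + toℕ (proj₂ p)) position≡))))))))
      where
      -- The centre for the ordered pair (u , v); the successor is there because first coordinate 0
      -- belongs to the vertices.
      c = combine (suc u) v
      w = at G zero zero c
      position≡ : (major (component w) , minor (component w)) ≡ (suc u , v)
      position≡ = trans (cong (λ c → major c , minor c) (component-at G zero zero c))
        (remQuot-combine (suc u) v)
      class≡edg : class w ≡ edg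
      class≡edg = trans (class-at G zero zero c) (trans (classIn-combine zero zero (suc u) v)
        (cong (λ b → if b then edg else off) u~v))
      w-centre = cong isCentre class≡edg
      -- For the classes `vtx` and `edg`, `joinsˢ` computes to true for either value of the flag.
      adjacent : ∀ {z} v → z ≡ ι v → adj⁺ z w ≡ true
      adjacent {z} v z≡ = trans (adj⁺-ι v w z≡)
        (cong (λ d → joinsˢ vtx d (does (component z ≟ᶠ component w))) class≡edg)

-- Fixed-parameter reductions

PolyFun-resp : (∀ x → f x ≡ g x) → PolyFun f → PolyFun g
PolyFun-resp f≗g F = record
  { program = program F
  ; bound   = bound F
  ; run     = λ x → let (t , d , t≤) = run F x in
      t , subst (λ y → program F ⊢ x ⇓ y [ t ]) (f≗g x) d , t≤
  }

addProgram mulProgram : Program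
addProgram = rec id ⟨ ε , tl ⨾ tl ⟩
mulProgram = rec ε (⟨ hd ⨾ tl , tl ⨾ tl ⟩ ⨾ addProgram)

add-⇓ : ∀ m n → ∃[ t ] addProgram ⊢ encℕ m · encℕ n ⇓ encℕ (m + n) [ t ]
add-⇓ zero    n = _ , rec-nil id-⇓
add-⇓ (suc m) n =
  _ , rec-· (rec-nil id-⇓) (proj₂ (add-⇓ m n)) (pair-⇓ ε-⇓ (⨾-⇓ tl-· tl-·))

mul-⇓ : ∀ m n → ∃[ t ] mulProgram ⊢ encℕ m · encℕ n ⇓ encℕ (m * n) [ t ]
mul-⇓ zero    n = _ , rec-nil ε-⇓
mul-⇓ (suc m) n =
  _ , rec-· (rec-nil ε-⇓) (proj₂ (mul-⇓ m n))
        (⨾-⇓ (pair-⇓ (⨾-⇓ hd-· tl-·) (⨾-⇓ tl-· tl-·)) (proj₂ (add-⇓ n (m * n))))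

-- Fixed-parameter reductions demand computable bounds; those of a composite are polynomials in the
-- given ones.
eval-computable : ∀ P → Computable (eval P)
eval-computable (con k) = program (constᵖ (encℕ k)) , λ n →
  let (t , d , _) = run (constᵖ (encℕ k)) (encℕ n) in t , d
eval-computable var = id , λ n → _ , id-⇓
eval-computable (P ⊕ Q) =
  let (p , P⇓) = eval-computable P ; (q , Q⇓) = eval-computable Q in
  ⟨ p , q ⟩ ⨾ addProgram , λ n →
    _ , ⨾-⇓ (pair-⇓ (proj₂ (P⇓ n)) (proj₂ (Q⇓ n))) (proj₂ (add-⇓ (eval P n) (eval Q n)))
eval-computable (P ⊗ Q) =
  let (p , P⇓) = eval-computable P ; (q , Q⇓) = eval-computable Q in
  ⟨ p , q ⟩ ⨾ mulProgram , λ n →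
    _ , ⨾-⇓ (pair-⇓ (proj₂ (P⇓ n)) (proj₂ (Q⇓ n))) (proj₂ (mul-⇓ (eval P n) (eval Q n)))

∘-computable : ∀ {k l : ℕ → ℕ} → Computable k → Computable l → Computable (λ n → l (k n))
∘-computable {k} (p , K⇓) (q , L⇓) = p ⨾ q , λ n → _ , ⨾-⇓ (proj₂ (K⇓ n)) (proj₂ (L⇓ (k n)))

record PolyReduction (Q R : Problem) : Set where
  private
    module Q = Problem Q
    module R = Problem R
  field
    reduce      : Q.Instance → R.Instance
    correct     : ∀ y → Q.Yes y ⇔ R.Yes (reduce y)
    transform   : Tree → Tree
    poly        : PolyFun transform
    encodes     : ∀ y → transform (Q.encode y) ≡ R.encode (reduce y)
    growth      : Poly
    parameter-≤ : ∀ y → R.parameter (reduce y) ≤ eval growth (Q.parameter y)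

-- The time k * n ^ c of the first reduction also bounds the size of its output. The total time is
-- thus polynomial in this product, and `eval-*` separates the part depending on the parameter from
-- a power of n.
≤ᶠᵖᵗ-PolyReduction : ∀ {P Q R} → P ≤ᶠᵖᵗ Q → PolyReduction Q R → P ≤ᶠᵖᵗ R
≤ᶠᵖᵗ-PolyReduction {P} {Q} {R} ρ σ = record
  { reduce       = λ x → σ.reduce (ρ.reduce x)
  ; correct      = λ x → mk⇔
      (λ yes → Equivalence.to (σ.correct _) (Equivalence.to (ρ.correct x) yes))
      (λ yes → Equivalence.from (ρ.correct x) (Equivalence.from (σ.correct _) yes))
  ; program      = ρ.program ⨾ program σ.poly
  ; f            = λ k → eval time (ρ.f k)
  ; f-computable = ∘-computable ρ.f-computable (eval-computable time)
  ; c            = ρ.c * deg time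
  ; fpt-time     = fpt-time
  ; g            = λ k → eval σ.growth (ρ.g k)
  ; g-computable = ∘-computable ρ.g-computable (eval-computable σ.growth)
  ; parameter-≤  = λ x → ≤-trans (σ.parameter-≤ (ρ.reduce x)) (eval-mono σ.growth (ρ.parameter-≤ x))
  }
  where
  module ρ = _≤ᶠᵖᵗ_ ρ
  module σ = PolyReduction σ
  module P = Problem P
  module Q = Problem Q
  module R = Problem R

  time : Poly
  time = con 1 ⊕ (var ⊕ bound σ.poly)

  fpt-time : ∀ x → ∃[ t ]
    (ρ.program ⨾ program σ.poly ⊢ P.encode x ⇓ R.encode (σ.reduce (ρ.reduce x)) [ t ] ×
     t ≤ eval time (ρ.f (P.parameter x)) * size (P.encode x) ^ (ρ.c * deg time))
  fpt-time x =
    let (s , d , s≤) = ρ.fpt-time x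
        (t , e , t≤) = run σ.poly (Q.encode (ρ.reduce x))
        k = ρ.f (P.parameter x)
        n = size (P.encode x)
        instance n^c≢0 = m^n≢0 n ρ.c
    in _ , ⨾-⇓ d (subst (λ z → program σ.poly ⊢ _ ⇓ z [ t ]) (σ.encodes (ρ.reduce x)) e) , (begin
      suc (s + t)
        ≤⟨ s≤s (+-monoʳ-≤ s (≤-trans t≤ (eval-mono (bound σ.poly) (size≤cost d)))) ⟩
      eval time s
        ≤⟨ eval-mono time s≤ ⟩
      eval time (k * n ^ ρ.c)
        ≤⟨ eval-* time k ⟩
      eval time k * (n ^ ρ.c) ^ deg time
        ≡⟨ cong (eval time k *_) (^-*-assoc n ρ.c (deg time)) ⟩
      eval time k * n ^ (ρ.c * deg time) ∎)
    where open ≤-Reasoning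

-- Translation of first-order sentences

translate : ∀ {n} → FO.Formula n → L₁.Formula n
translate (FO.eq x y)   = L₁.eq x y
translate (FO.edge x y) = φᴱ x y
translate (FO.neg φ)    = L₁.neg (translate φ)
translate (FO.or φ ψ)   = L₁.or (translate φ) (translate ψ)
translate (FO.ex φ)     = L₁.ex (φⱽ zero ∧ᶠ translate φ)

translate-correct : ∀ G {n} (φ : FO.Formula n) ρ →
  L₁.⟦_⟧ (coloured G) (translate φ) (Vec.map (Interpretation.ι G) ρ) ≡ FO.⟦_⟧ G φ ρ
translate-correct G (FO.eq x y) ρ
  rewrite lookup-map x (Interpretation.ι G) ρ | lookup-map y (Interpretation.ι G) ρ =
  does-⇔ (mk⇔ (inject≤-injective n≤order⁺ n≤order⁺ _ _) (cong ι))
    (ι (lookup ρ x) ≟ᶠ ι (lookup ρ y)) (lookup ρ x ≟ᶠ lookup ρ y)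
  where open Interpretation G
translate-correct G (FO.edge x y) ρ =
  ⇔⇒≡ (φᴱ-correct x y (Vec.map ι ρ) (lookup-map x ι ρ) (lookup-map y ι ρ))
  where open Interpretation G
translate-correct G (FO.neg φ) ρ  = cong not (translate-correct G φ ρ)
translate-correct G (FO.or φ ψ) ρ = cong₂ _∨_ (translate-correct G φ ρ) (translate-correct G ψ ρ)
translate-correct G (FO.ex φ) ρ   = ⇔⇒≡ (mk⇔ to from)
  where
  open Interpretation G
  ρ⁺ = Vec.map ι ρ
  unfold : ∀ u → L₁.⟦_⟧ (coloured G) (φⱽ zero ∧ᶠ translate φ) (u ∷ ρ⁺) ≡
                 L₁.⟦_⟧ (coloured G) (φⱽ zero) (u ∷ ρ⁺) ∧ L₁.⟦_⟧ (coloured G) (translate φ) (u ∷ ρ⁺)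
  unfold u = not-∨-not (L₁.⟦_⟧ (coloured G) (φⱽ zero) (u ∷ ρ⁺)) _
  to : L₁.⟦_⟧ (coloured G) (translate (FO.ex φ)) ρ⁺ ≡ true → FO.⟦_⟧ G (FO.ex φ) ρ ≡ true
  to eq =
    let (u , p) = Equivalence.to any-allFin eq
        q = trans (sym (unfold u)) p
        (v , u≡ιv) = Equivalence.to (φⱽ-correct zero (u ∷ ρ⁺)) (∧-conicalˡ _ _ q)
        r = ∧-conicalʳ (L₁.⟦_⟧ (coloured G) (φⱽ zero) (u ∷ ρ⁺)) _ q
    in Equivalence.from any-allFin (v , trans (sym (translate-correct G φ (v ∷ ρ)))
         (subst (λ u → L₁.⟦_⟧ (coloured G) (translate φ) (u ∷ ρ⁺) ≡ true) u≡ιv r))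
  from : FO.⟦_⟧ G (FO.ex φ) ρ ≡ true → L₁.⟦_⟧ (coloured G) (translate (FO.ex φ)) ρ⁺ ≡ true
  from eq =
    let (v , p) = Equivalence.to any-allFin eq in
    Equivalence.from any-allFin (ι v , trans (unfold (ι v)) (cong₂ _∧_
      (Equivalence.from (φⱽ-correct zero (ι v ∷ ρ⁺)) (v , refl))
      (trans (translate-correct G φ (v ∷ ρ)) p)))

-- The translation as a program on encoded formulas

andᵗ : Tree → Tree → Tree
andᵗ p q = encℕ 2 · encℕ 3 · (encℕ 2 · p) · (encℕ 2 · q)

exᵗ : Tree → Tree
exᵗ p = encℕ 4 · andᵗ (encL₁ {1} (φⱽ zero)) p

-- Here `b` holds the two variable indices. Prefixing `nil` shifts an index past the new quantifier,
-- and the `nil` paired with it is index 0, the quantified edge centre.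
edgeᵗ : Tree → Tree
edgeᵗ b = encℕ 4 · andᵗ (encL₁ {1} (L₁.neg (L₁.or (L₁.C₁ zero) (L₁.C₂ zero))))
  (andᵗ (encℕ 7 · ((nil · hdᵗ b) · nil) · encTerm (#neighbours rgt-leaf) · encTerm (#neighbours lft-leaf))
        (encℕ 7 · ((nil · tlᵗ b) · nil) · encTerm (#neighbours rgt-leaf) · encTerm (#neighbours rgt-leaf)))

andᵖ : PolyFun f → PolyFun g → PolyFun (λ x → andᵗ (f x) (g x))
andᵖ F G =
  ⟨ constᵖ (encℕ 2) , ⟨ constᵖ (encℕ 3) , ⟨ ⟨ constᵖ (encℕ 2) , F ⟩ᵖ , ⟨ constᵖ (encℕ 2) , G ⟩ᵖ ⟩ᵖ ⟩ᵖ ⟩ᵖ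

exᵖ : PolyFun f → PolyFun (λ x → exᵗ (f x))
exᵖ F = ⟨ constᵖ (encℕ 4) , andᵖ (constᵖ (encL₁ {1} (φⱽ zero))) F ⟩ᵖ

abstract
  edgeᵖ : PolyFun edgeᵗ
  edgeᵖ = ⟨ constᵖ (encℕ 4) , andᵖ (constᵖ (encL₁ {1} (L₁.neg (L₁.or (L₁.C₁ zero) (L₁.C₂ zero)))))
    (andᵖ (comparison hdᵖ (encTerm (#neighbours rgt-leaf) · encTerm (#neighbours lft-leaf)))
          (comparison tlᵖ (encTerm (#neighbours rgt-leaf) · encTerm (#neighbours rgt-leaf)))) ⟩ᵖ
    where
    comparison : PolyFun f → ∀ terms → PolyFun (λ b → encℕ 7 · ((nil · f b) · nil) · terms)
    comparison F terms = ⟨ constᵖ (encℕ 7) , ⟨ ⟨ ⟨ nilᵖ , F ⟩ᵖ , nilᵖ ⟩ᵖ , constᵖ terms ⟩ᵖ ⟩ᵖ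

  exSize : ℕ
  exSize = size (exᵗ nil)

  size-exᵗ : ∀ v → size (exᵗ v) ≤ exSize + size v
  -- The slack of 1 is the `nil` in the hole, which `exSize` counts in addition.
  size-exᵗ v = n≤1+n (size (exᵗ v))

-- v is the translation of b, and w the pair of the translations of its two subtrees,
-- which is needed for disjunctions, where b is a pair of formulas.
nodeᵗ : Tree → Tree → Tree → Tree → Tree
nodeᵗ a b v w =
  -- The tag is unary: the nested tests single out 0 to 3 and send every longer tag to the
  -- quantifier case.
  ifᵗ a (ifᵗ (tlᵗ a) (ifᵗ (tlᵗ (tlᵗ a)) (ifᵗ (tlᵗ (tlᵗ (tlᵗ a)))
    (exᵗ v) (a · w)) (a · v)) (edgeᵗ b)) (a · b)

mutual
  translateᵗ : Tree → Tree
  translateᵗ nil     = nil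
  translateᵗ (a · b) = nodeᵗ a b (translateᵗ b) (translatePairᵗ b)

  translatePairᵗ : Tree → Tree
  translatePairᵗ nil     = nil
  translatePairᵗ (a · b) = translateᵗ a · translateᵗ b

translateᵗ-correct : ∀ {n} (φ : FO.Formula n) → translateᵗ (encFO φ) ≡ encL₁ (translate φ)
translateᵗ-correct (FO.eq x y)   = refl
translateᵗ-correct (FO.edge x y) = refl
translateᵗ-correct (FO.neg φ)    = cong (encℕ 2 ·_) (translateᵗ-correct φ)
translateᵗ-correct (FO.or φ ψ)   =
  cong (encℕ 3 ·_) (cong₂ _·_ (translateᵗ-correct φ) (translateᵗ-correct ψ))
translateᵗ-correct (FO.ex φ)     = cong exᵗ (translateᵗ-correct φ)

nodeGrowth : Poly
nodeGrowth = con exSize ⊕ (var ⊕ bound edgeᵖ)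

size-nodeᵗ : ∀ {s} a b v w → size v ≤ s → size w ≤ s →
             size (nodeᵗ a b v w) ≤ s + eval nodeGrowth (size (a · b))
size-nodeᵗ {s} a b v w v≤ w≤ = bound-node a refl
  where
  open ≤-Reasoning
  k e : ℕ
  k = exSize
  e = eval (bound edgeᵖ) (size (a · b))

  by-node : ∀ {x} → x ≤ s + size (a · b) → x ≤ s + (k + (size (a · b) + e))
  by-node x≤ = ≤-trans x≤ (+-monoʳ-≤ s (≤-trans (m≤m+n (size (a · b)) e) (m≤n+m _ k)))

  tagged : ∀ {x} → size x ≤ s → size (a · x) ≤ s + (k + (size (a · b) + e))
  tagged {x} x≤ = by-node (begin
    suc (size a + size x) ≤⟨ s≤s (+-mono-≤ (m≤m+n (size a) (size b)) x≤) ⟩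
    size (a · b) + s      ≡⟨ +-comm (size (a · b)) s ⟩
    s + size (a · b)      ∎)

  |b|≤ : size b ≤ size (a · b)
  |b|≤ = ≤-trans (m≤n+m (size b) (size a)) (n≤1+n _)

  bound-node : ∀ c → a ≡ c → size (nodeᵗ c b v w) ≤ s + (k + (size (a · b) + e))
  bound-node nil                 refl = by-node (m≤n+m (size (a · b)) s)
  bound-node (_ · nil)           refl = begin
    size (edgeᵗ b)                     ≤⟨ size-≤ edgeᵖ b ⟩
    eval (bound edgeᵖ) (size b)        ≤⟨ eval-mono (bound edgeᵖ) |b|≤ ⟩
    e                                  ≤⟨ m≤n+m e (size (a · b)) ⟩
    size (a · b) + e                   ≤⟨ m≤n+m _ k ⟩
    k + (size (a · b) + e)             ≤⟨ m≤n+m _ s ⟩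
    s + (k + (size (a · b) + e))       ∎
  bound-node (_ · _ · nil)       refl = tagged v≤
  bound-node (_ · _ · _ · nil)   refl = tagged w≤
  bound-node (_ · _ · _ · _ · _) refl = begin
    size (exᵗ v)                       ≤⟨ size-exᵗ v ⟩
    k + size v                         ≤⟨ +-monoʳ-≤ k v≤ ⟩
    k + s                              ≤⟨ +-monoˡ-≤ s (m≤m+n k (size (a · b) + e)) ⟩
    k + (size (a · b) + e) + s         ≡⟨ +-comm _ s ⟩
    s + (k + (size (a · b) + e))       ∎

1≤eval-nodeGrowth : ∀ {N} → 1 ≤ N → 1 ≤ eval nodeGrowth N
1≤eval-nodeGrowth {N} 1≤N = ≤-trans 1≤N (≤-trans (m≤m+n N (eval (bound edgeᵖ) N)) (m≤n+m _ exSize))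

-- Taken separately, each of the two functions uses a translated subtree at most once, so sizes grow
-- additively. A step computing both copies the translation of `b` twice, so `growthᵖ` does not
-- apply and this bound is fed to `recᵖ`.
size-translateᵗ : ∀ N x → size x ≤ N → size (translateᵗ x) ≤ size x * eval nodeGrowth N ×
                                       size (translatePairᵗ x) ≤ size x * eval nodeGrowth N
size-translateᵗ N nil     |x|≤N = 1≤D , 1≤D
  where
  1≤D = ≤-trans (1≤eval-nodeGrowth |x|≤N) (≤-reflexive (sym (*-identityˡ (eval nodeGrowth N))))
size-translateᵗ N (a · b) |x|≤N = translated , translatedPair
  where
  open ≤-Reasoning
  D = eval nodeGrowth N
  1≤D = 1≤eval-nodeGrowth (≤-trans (1≤size (a · b)) |x|≤N)
  IHa = size-translateᵗ N a (≤-trans (≤-trans (m≤m+n (size a) (size b)) (n≤1+n _)) |x|≤N)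
  IHb = size-translateᵗ N b (≤-trans (≤-trans (m≤n+m (size b) (size a)) (n≤1+n _)) |x|≤N)

  translated : size (translateᵗ (a · b)) ≤ size (a · b) * D
  translated = begin
    size (translateᵗ (a · b))
      ≤⟨ size-nodeᵗ a b (translateᵗ b) (translatePairᵗ b) (proj₁ IHb) (proj₂ IHb) ⟩
    size b * D + eval nodeGrowth (size (a · b))
      ≤⟨ +-monoʳ-≤ (size b * D) (eval-mono nodeGrowth |x|≤N) ⟩
    size b * D + D
      ≡⟨ +-comm (size b * D) D ⟩
    suc (size b) * D
      ≤⟨ *-monoˡ-≤ D (s≤s (m≤n+m (size b) (size a))) ⟩
    size (a · b) * D ∎

  translatedPair : size (translatePairᵗ (a · b)) ≤ size (a · b) * D
  translatedPair = begin
    suc (size (translateᵗ a) + size (translateᵗ b))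
      ≤⟨ s≤s (+-mono-≤ (proj₁ IHa) (proj₁ IHb)) ⟩
    1 + (size a * D + size b * D)
      ≤⟨ +-monoˡ-≤ (size a * D + size b * D) 1≤D ⟩
    D + (size a * D + size b * D)
      ≡⟨ cong (λ m → D + m) (*-distribʳ-+ D (size a) (size b)) ⟨
    size (a · b) * D ∎

-- `rec` runs a single recursion, so the mutual one is carried out on pairs of both values and
-- projected at the end.
translateᵖ : PolyFun translateᵗ
translateᵖ = PolyFun-resp (λ x → cong hdᵗ (rec-translateᵗ x nil))
  (⟨ idᵖ , nilᵖ ⟩ᵖ ⟫ recᵖ {f = base} {g = step} (constᵖ (nil · nil)) stepᵖ
    (con 1 ⊕ (var ⊗ nodeGrowth ⊕ var ⊗ nodeGrowth)) size-rec ⟫ hdᵖ)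
  where
  base step : Tree → Tree
  base _ = nil · nil
  step z = nodeᵗ (stepHead z) (stepTail z) (hdᵗ (stepRest z)) (tlᵗ (stepRest z)) ·
           hdᵗ (hdᵗ (tlᵗ z)) · hdᵗ (stepRest z)

  stepᵖ : PolyFun step
  stepᵖ = ⟨ nodeᵖ , ⟨ tlᵖ ⟫ hdᵖ ⟫ hdᵖ , stepRestᵖ ⟫ hdᵖ ⟩ᵖ ⟩ᵖ
    where
    aᵖ = stepHeadᵖ
    nodeᵖ =
      ifᵖ aᵖ (ifᵖ (aᵖ ⟫ tlᵖ) (ifᵖ (aᵖ ⟫ tlᵖ ⟫ tlᵖ) (ifᵖ (aᵖ ⟫ tlᵖ ⟫ tlᵖ ⟫ tlᵖ)
        (exᵖ (stepRestᵖ ⟫ hdᵖ)) ⟨ aᵖ , stepRestᵖ ⟫ tlᵖ ⟩ᵖ) ⟨ aᵖ , stepRestᵖ ⟫ hdᵖ ⟩ᵖ)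
        (stepTailᵖ ⟫ edgeᵖ)) ⟨ aᵖ , stepTailᵖ ⟩ᵖ

  rec-translateᵗ : ∀ x e → recᵗ base step x e ≡ translateᵗ x · translatePairᵗ x
  rec-translateᵗ nil     e = refl
  rec-translateᵗ (a · b) e = cong₂ (λ u v → step (((a · b) · e) · (u · v)))
    (rec-translateᵗ a e) (rec-translateᵗ b e)

  size-rec : ∀ x e → size (recᵗ base step x e) ≤
             eval (con 1 ⊕ (var ⊗ nodeGrowth ⊕ var ⊗ nodeGrowth)) (size x + size e)
  size-rec x e rewrite rec-translateᵗ x e =
    let N = size x + size e ; (t≤ , p≤) = size-translateᵗ N x (m≤m+n (size x) (size e))
        widen = *-monoˡ-≤ (eval nodeGrowth N) (m≤m+n (size x) (size e))
    in s≤s (+-mono-≤ (≤-trans t≤ widen) (≤-trans p≤ widen))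

modelChecking : PolyReduction (FO-ModelChecking (λ _ → ⊤)) (L₁-ModelChecking LabelledDepth2)
modelChecking = record
  { reduce      = λ (φ , G , _) → translate φ , coloured G , coloured-labelled G
  ; correct     = λ (φ , G , _) → mk⇔
      (trans (translate-correct G φ [])) (trans (sym (translate-correct G φ [])))
  ; transform   = λ z → translateᵗ (hdᵗ z) · colouredᵗ (tlᵗ z)
  ; poly        = ⟨ hdᵖ ⟫ translateᵖ , tlᵖ ⟫ colouredᵖ ⟩ᵖ
  ; encodes     = λ (φ , G , _) → cong₂ _·_ (translateᵗ-correct φ) (colouredᵗ-correct G)
  -- The new parameter is the size of an output of `translateᵖ`, hence at most its time bound.
  ; growth      = bound translateᵖ
  ; parameter-≤ = λ (φ , G , _) →
      subst (λ z → size z ≤ eval (bound translateᵖ) (size (encFO φ))) (translateᵗ-correct φ)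
        (size-≤ translateᵖ (encFO φ))
  }

mainTheorem8 : Σ (ColouredGraph → Set) λ K → ShrubDepth≤ 2 (Reducts K) ×
    (Σ (L₁.Formula 1) λ φV → Σ (L₁.Formula 2) λ φE →
    Σ (Graph → ColouredGraph) λ F →
    PolyTime encGraph encColouredGraph F ×
    (∀ (G : Graph) →
    K (F G) ×
    Σ (Graph.order G ≤ ColouredGraph.order (F G)) λ n≤N →
    (∀ (v : ColouredGraph.V (F G)) →
    (F G L₁.⊨ φV [ v ∷ [] ]) ⇔ (∃ λ (u : Graph.V G) → v ≡ inject≤ u n≤N)) ×
    (∀ (v₁ v₂ : Graph.V G) →
    (F G L₁.⊨ φE [ inject≤ v₁ n≤N ∷ inject≤ v₂ n≤N ∷ [] ]) ⇔ (Graph.adj G v₁ v₂ ≡ true))))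
    × (AW[*]-hard (FO-ModelChecking (λ _ → ⊤)) → AW[*]-hard (L₁-ModelChecking K))
mainTheorem8 =
  LabelledDepth2 , shrubDepth ,
  (φⱽ zero , φᴱ zero (suc zero) , coloured ,
   polyTime {encA = encGraph} {encColouredGraph} {coloured} colouredᵖ colouredᵗ-correct ,
   λ G → let open Interpretation G in
     coloured-labelled G , n≤order⁺ ,
     (λ v → φⱽ-correct zero (v ∷ [])) ,
     (λ v₁ v₂ → φᴱ-correct zero (suc zero) (ι v₁ ∷ ι v₂ ∷ []) refl refl)) ,
  λ FO-hard Q Q∈AW → ≤ᶠᵖᵗ-PolyReduction (FO-hard Q Q∈AW) modelChecking
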